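{- Let $\lambda$ be a partition and $T$ a semistandard set-valued tableau of (straight) shape $\lambda$ with entries in $[m]$. Let $\mathsf{res}(T)=h^m\cdots h^1$ and let $[\mathbf{k},\mathbf{h}]^t$ be the corresponding decreasing Hecke biword. Apply Hecke row insertion from the right to $[\mathbf{k},\mathbf{h}]^t$ and obtain the pair of tableaux $(P,Q)$. Then $Q=T$.
   Context: Tableaux are in French notation; cell $(i,j)$ is in row $i$ (from the bottom), column $j$. A semistandard set-valued tableau fills each cell with a nonempty finite set of positive integers such that $\max(A)\leqslant\min(B)$ for horizontally adjacent cells $A$ left of $B$, and $\max(A)<\min(C)$ for vertically adjacent $A$ below $C$. Residue map: the content of cell $(i,j)$ of $\lambda$ is $\ell(\lambda)+j-i$ ($\ell(\lambda)$ = number of parts); $\mathsf{res}(T)=h^m\cdots h^1$ where $h^k=h^k_1h^k_2\cdots h^k_{\ell_k}$ lists in decreasing order the contents of the cells of $T$ containing $k$. The decreasing Hecke biword of $h^m\cdots h^1$ is the two-row array whose columns, from left to right, are $[m;h^m_1],\dots,[m;h^m_{\ell_m}],[m-1;h^{m-1}_1],\dots,[1;h^1_1],\dots,[1;h^1_{\ell_1}]$ (top entry; bottom entry). Hecke row insertion from the right: start with $P_0,Q_0$ empty; read the columns right to left; if the current column is $[y;x]$, insert $x$ into the first row of $P_i$ by the following rules for inserting $x$ into a row $R$. (1) If $x\geqslant z$ for all $z\in R$: (a) if appending $x$ to the right end of $R$ gives an increasing tableau (rows and columns strictly increasing), do so and add a cell containing $y$ to $Q_i$ in the same position; stop. (b)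 Otherwise $R$ is unchanged, $y$ is added to the set in the existing corner cell of $Q_i$ whose column contains the rightmost box of $R$; stop. (2) Otherwise let $z$ be the smallest entry of $R$ with $z>x$: (a) if replacing $z$ by $x$ gives an increasing tableau, do so, and insert $z$ into the next row up; (b) otherwise leave $R$ unchanged and insert $z$ into the next row up. After all columns are processed one obtains $(P,Q)$. -}

module Defs where

open import Data.Nat using (ℕ; zero; suc; _+_; _∸_; _≤_; _<_; _≥_; _<ᵇ_; _≤ᵇ_; _≡ᵇ_; _⊔_; _⊓_)
open import Data.Bool using (Bool; true; false; _∧_; if_then_else_; not)
open import Data.List using (List; []; _∷_; _++_; length; map; concat; reverse; foldr; foldl; [_])
open import Data.Bool.ListAction using (all; any)
open import Data.List.Relation.Unary.All using (All)
open import Data.List.Relation.Binary.Pointwise using (Pointwise)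
open import Data.List.Relation.Unary.Linked using (Linked)
open import Data.Maybe using (Maybe; just; nothing; maybe)
open import Data.Product using (_×_; _,_; proj₁; proj₂)
open import Data.Unit using (⊤)
open import Relation.Binary.PropositionalEquality using (_≡_; _≢_)

-- Conventions
--
-- A tableau is a list of rows, listed from the BOTTOM row (row 1) upward
-- (French notation); a row is a list of cells from left (column 1) to right.
-- A cell of a set-valued tableau is a finite set of positive integers,
-- represented canonically as a strictly increasing list of naturals.
-- A cell of an increasing tableau (the insertion tableau P) is a natural.

SVTableau : Set
SVTableau = List (List (List ℕ))

Tableau : Set
Tableau = List (List ℕ)

shape : ∀ {A : Set} → List (List A) → List ℕ
shape = map length

IsPartition : List ℕ → Set
IsPartition λ′ = Linked _≥_ λ′ × All (λ p → 1 ≤ p) λ′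

maxL : List ℕ → ℕ
maxL = foldr _⊔_ 0

minL : List ℕ → ℕ
minL [] = 0
minL (a ∷ as) = foldr _⊓_ a as

GoodCell : ℕ → List ℕ → Set
GoodCell m A = A ≢ [] × Linked _<_ A × All (λ a → 1 ≤ a × a ≤ m) A

ColRel : List (List ℕ) → List (List ℕ) → Set
ColRel (A ∷ L) (C ∷ U) = maxL A < minL C × ColRel L U
ColRel _ _ = ⊤

-- T is a semistandard set-valued tableau with entries in [m]
-- (its shape being a partition is imposed separately)
SemistandardSV : ℕ → SVTableau → Set
SemistandardSV m T =
  All (All (GoodCell m)) T
  × All (Linked (λ A B → maxL A ≤ minL B)) T
  × Linked ColRel T

memb : ℕ → List ℕ → Bool
memb k = any (λ a → a ≡ᵇ k)

-- contents of cells of row i (1-indexed) containing k, starting at column j;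
-- content of cell (i,j) is ℓ + j - i
rowContents : ℕ → ℕ → ℕ → ℕ → List (List ℕ) → List ℕ
rowContents ℓ k i j [] = []
rowContents ℓ k i j (A ∷ R) =
  (if memb k A then [ (ℓ + j) ∸ i ] else []) ++ rowContents ℓ k i (suc j) R

allContents : ℕ → ℕ → ℕ → SVTableau → List ℕ
allContents ℓ k i [] = []
allContents ℓ k i (R ∷ T) = rowContents ℓ k i 1 R ++ allContents ℓ k (suc i) T

insertDec : ℕ → List ℕ → List ℕ
insertDec x [] = [ x ]
insertDec x (a ∷ as) = if a <ᵇ x then x ∷ a ∷ as else a ∷ insertDec x as

sortDec : List ℕ → List ℕ
sortDec = foldr insertDec []

hWord : ℕ → SVTableau → List ℕ
hWord k T = sortDec (allContents (length T) k 1 T)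

-- decreasing Hecke biword of res(T) = h^m ... h^1 as a list of columns
-- (top , bottom), from left to right
biwordFrom : ℕ → SVTableau → List (ℕ × ℕ)
biwordFrom zero T = []
biwordFrom (suc k) T = map (λ h → (suc k , h)) (hWord (suc k) T) ++ biwordFrom k T

heckeBiword : ℕ → SVTableau → List (ℕ × ℕ)
heckeBiword m T = biwordFrom m T

rowIncB : List ℕ → Bool
rowIncB [] = true
rowIncB (a ∷ []) = true
rowIncB (a ∷ b ∷ r) = (a <ᵇ b) ∧ rowIncB (b ∷ r)

colOKB : List ℕ → List ℕ → Bool
colOKB _ [] = true
colOKB [] (_ ∷ _) = false
colOKB (a ∷ L) (b ∷ U) = (a <ᵇ b) ∧ colOKB L U

colsOKB : Tableau → Bool
colsOKB [] = true
colsOKB (R ∷ []) = true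
colsOKB (R ∷ S ∷ P) = colOKB R S ∧ colsOKB (S ∷ P)

nonemptyB : List ℕ → Bool
nonemptyB [] = false
nonemptyB (_ ∷ _) = true

isIncreasingB : Tableau → Bool
isIncreasingB P = all nonemptyB P ∧ all rowIncB P ∧ colsOKB P

modifyAt : ∀ {A : Set} → ℕ → (A → A) → List A → List A
modifyAt n f [] = []
modifyAt zero f (a ∷ as) = f a ∷ as
modifyAt (suc n) f (a ∷ as) = a ∷ modifyAt n f as

insertSet : ℕ → List ℕ → List ℕ
insertSet y [] = [ y ]
insertSet y (a ∷ s) =
  if y <ᵇ a then y ∷ a ∷ s else (if y ≡ᵇ a then a ∷ s else a ∷ insertSet y s)

minGt : ℕ → List ℕ → Maybe ℕ
minGt x = foldr (λ z acc → if x <ᵇ z then just (maybe (z ⊓_) z acc) else acc) nothing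

indexOf : ℕ → List ℕ → ℕ
indexOf z [] = zero
indexOf z (a ∷ R) = if a ≡ᵇ z then zero else suc (indexOf z R)

-- index (0-indexed) of the highest row of Q having a cell in column c
-- (0-indexed); this row's cell in column c is the corner cell of column c
topRowWithCol : ℕ → SVTableau → Maybe ℕ
topRowWithCol c Q = go 0 Q nothing
  where
  go : ℕ → SVTableau → Maybe ℕ → Maybe ℕ
  go r [] acc = acc
  go r (R ∷ Q′) acc = go (suc r) Q′ (if c <ᵇ length R then just r else acc)

addToCorner : ℕ → ℕ → SVTableau → SVTableau
addToCorner c y Q with topRowWithCol c Q
... | nothing = Q
... | just r = modifyAt r (modifyAt c (insertSet y)) Q

-- insert x (with recording letter y) into row r of P, where `rest` is the
-- list of rows of P from row r upward (used for structural recursion)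
insertRow : List (List ℕ) → ℕ → ℕ → ℕ → Tableau → SVTableau → Tableau × SVTableau
insertRow [] r x y P Q =
  if isIncreasingB (P ++ [ [ x ] ]) then (P ++ [ [ x ] ] , Q ++ [ [ [ y ] ] ]) else (P , Q)
insertRow (R ∷ rest) r x y P Q with minGt x R
... | nothing =
  let P′ = modifyAt r (λ S → S ++ [ x ]) P in
  if isIncreasingB P′
    then (P′ , modifyAt r (λ S → S ++ [ [ y ] ]) Q)
    else (P , addToCorner (length R ∸ 1) y Q)
... | just z =
  let P′ = modifyAt r (modifyAt (indexOf z R) (λ _ → x)) P in
  if isIncreasingB P′
    then insertRow rest (suc r) z y P′ Q
    else insertRow rest (suc r) z y P Q

heckeStep : Tableau × SVTableau → ℕ × ℕ → Tableau × SVTableau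
heckeStep (P , Q) (y , x) = insertRow P 0 x y P Q

heckeInsertRight : List (ℕ × ℕ) → Tableau × SVTableau
heckeInsertRight w = foldl heckeStep ([] , []) (reverse w)

{-# OPTIONS --safe #-}

-- At every moment P is determined by the shape of Q: with 0-indexed cells, ℓ rows in T and column j of height
-- H j, the cell (i, j) of P holds i + ℓ + 1 + j - H j. Inserting the content ℓ + j - i of an addable corner
-- (i, j) lowers column j by one, row after row, and puts ℓ + j on its top, so Q gains the cell (i, j). Inserting
-- the content of a removable corner (i, j) leaves P unchanged: the letter entering each row is blocked by
-- an equal entry, and the insertion ends in the first row not reaching column j + 1, so the letter is recorded
-- at the top of column j, which is (i, j). Semistandardness says that the letters of T, taken by increasing value
-- and then by increasing content, always occupy an addable or a removable corner of what precedes them.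

module Submission where

open import Defs
open import Data.Nat using (ℕ; zero; suc; _+_; _∸_; _≤_; _<_; z≤n; s≤s; z<s; s<s; _<ᵇ_; _≡ᵇ_; _⊔_; _≟_; _<?_)
open import Data.Nat.Properties
open import Data.Bool using (Bool; true; false; T; if_then_else_; _∧_)
open import Data.Bool.Properties using (T-≡; T-∧)
open import Data.Bool.ListAction using (all)
open import Data.List using (List; []; _∷_; _++_; [_]; length; map; foldr; applyUpTo; filter)
open import Data.List.Properties using (length-applyUpTo; applyUpTo-∷ʳ; foldr-++; foldr-map; reverse-foldl; filter-accept; filter-reject; filter-all; filter-none)
open import Data.Maybe using (Maybe; just; nothing)
open import Data.Product using (_×_; _,_; proj₁; proj₂; ∃; ∃₂)
open import Data.Sum using (_⊎_; inj₁; inj₂; [_,_]′)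
open import Data.Empty using (⊥)
open import Data.Unit using (tt)
open import Function using (_∘_; Equivalence)
open import Relation.Nullary using (¬_; yes; no; contradiction)
open import Relation.Binary.Definitions using (tri<; tri≈; tri>)
open import Relation.Binary.PropositionalEquality using (_≡_; _≢_; refl; sym; trans; cong; cong₂; subst; subst₂; module ≡-Reasoning)
open import Data.List.Membership.Propositional using (_∈_; _∉_)
open import Data.List.Membership.Propositional.Properties using (∈-filter⁺; ∈-++⁺ˡ; ∈-++⁺ʳ; ∈-++⁻)
open import Data.List.Relation.Unary.Any as Any using (here; there)
open import Data.List.Relation.Unary.Any.Properties using (any⁺; any⁻)
open import Data.List.Relation.Unary.All as All using (All; []; _∷_)
import Data.List.Relation.Unary.All.Properties as All
open import Data.List.Relation.Unary.AllPairs using (AllPairs; []; _∷_)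
import Data.List.Relation.Unary.AllPairs.Properties as AllPairs
open import Data.List.Relation.Unary.Linked using (Linked; []; [-]; _∷_)
import Data.List.Relation.Unary.Linked.Properties as Linked
open import Data.List.Relation.Binary.Permutation.Propositional using (_↭_; ↭-refl; ↭-prep; ↭-swap; ↭-trans; ↭-sym)
open import Data.List.Relation.Binary.Permutation.Propositional.Properties using (All-resp-↭; ∈-resp-↭)

private variable
  A : Set

-- Boolean tests and pointwise updates.

T⇒≡true : ∀ {b} → T b → b ≡ true
T⇒≡true = Equivalence.to T-≡

≡true⇒T : ∀ {b} → b ≡ true → T b
≡true⇒T = Equivalence.from T-≡

¬true⇒false : ∀ {b} → b ≢ true → b ≡ false
¬true⇒false {false} _ = refl
¬true⇒false {true} h = contradiction refl h

∧-intro : ∀ {a b} → T a → T b → T (a ∧ b)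
∧-intro p q = Equivalence.from T-∧ (p , q)

∧-elim : ∀ {a b} → T (a ∧ b) → T a × T b
∧-elim = Equivalence.to T-∧

<ᵇ-true : ∀ {m n} → m < n → (m <ᵇ n) ≡ true
<ᵇ-true = T⇒≡true ∘ <⇒<ᵇ

<ᵇ-false : ∀ {m n} → n ≤ m → (m <ᵇ n) ≡ false
<ᵇ-false {m} {n} n≤m = ¬true⇒false λ e → <⇒≱ (<ᵇ⇒< m n (≡true⇒T e)) n≤m

≡ᵇ-true : ∀ {m n} → m ≡ n → (m ≡ᵇ n) ≡ true
≡ᵇ-true {m} {n} = T⇒≡true ∘ ≡⇒≡ᵇ m n

≡ᵇ-false : ∀ {m n} → m ≢ n → (m ≡ᵇ n) ≡ false
≡ᵇ-false {m} {n} m≢n = ¬true⇒false λ e → m≢n (≡ᵇ⇒≡ m n (≡true⇒T e))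

upd : (ℕ → A) → ℕ → A → ℕ → A
upd f k v i with i ≟ k
... | yes _ = v
... | no _ = f i

upd-same : ∀ (f : ℕ → A) k {v} → upd f k v k ≡ v
upd-same f k with k ≟ k
... | yes _ = refl
... | no k≢k = contradiction refl k≢k

upd-other : ∀ (f : ℕ → A) k {v i} → i ≢ k → upd f k v i ≡ f i
upd-other f k {i = i} i≢k with i ≟ k
... | yes i≡k = contradiction i≡k i≢k
... | no _ = refl

-- Tableaux as functions on their cells

applyUpTo-cong : ∀ {f g : ℕ → A} n → (∀ i → i < n → f i ≡ g i) → applyUpTo f n ≡ applyUpTo g n
applyUpTo-cong zero h = refl
applyUpTo-cong (suc n) h = cong₂ _∷_ (h 0 z<s) (applyUpTo-cong n λ i i<n → h (suc i) (s<s i<n))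

modifyAt-applyUpTo : ∀ k (g : A → A) (f f′ : ℕ → A) n →
  f′ k ≡ g (f k) → (∀ i → i < n → i ≢ k → f′ i ≡ f i) →
  modifyAt k g (applyUpTo f n) ≡ applyUpTo f′ n
modifyAt-applyUpTo k g f f′ zero at off = refl
modifyAt-applyUpTo zero g f f′ (suc n) at off =
  cong₂ _∷_ (sym at) (applyUpTo-cong n λ i i<n → sym (off (suc i) (s<s i<n) λ ()))
modifyAt-applyUpTo (suc k) g f f′ (suc n) at off =
  cong₂ _∷_ (sym (off 0 z<s λ ()))
    (modifyAt-applyUpTo k g (f ∘ suc) (f′ ∘ suc) n at
      λ i i<n i≢k → off (suc i) (s<s i<n) (i≢k ∘ suc-injective))

-- Only the values of `p` inside the shape matter, so fillings are total functions and conditions on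
-- them can be stated without bounds.
tab : ℕ → (ℕ → ℕ) → (ℕ → ℕ → A) → List (List A)
tab n μ p = applyUpTo (λ i → applyUpTo (p i) (μ i)) n

tab-cong : ∀ n {μ μ′} {p p′ : ℕ → ℕ → A} → (∀ i → i < n → μ i ≡ μ′ i) →
  (∀ i j → i < n → j < μ′ i → p i j ≡ p′ i j) → tab n μ p ≡ tab n μ′ p′
tab-cong n {p = p} hμ hp = applyUpTo-cong n λ i i<n →
  trans (cong (applyUpTo (p i)) (hμ i i<n)) (applyUpTo-cong _ λ j j<μ → hp i j i<n j<μ)

tab-modifyAt : ∀ n μ (p p′ : ℕ → ℕ → A) i₀ j₀ g → p′ i₀ j₀ ≡ g (p i₀ j₀) →
  (∀ i j → i ≢ i₀ ⊎ j ≢ j₀ → p′ i j ≡ p i j) →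
  modifyAt i₀ (modifyAt j₀ g) (tab n μ p) ≡ tab n μ p′
tab-modifyAt n μ p p′ i₀ j₀ g at off = modifyAt-applyUpTo i₀ _ _ _ n
  (sym (modifyAt-applyUpTo j₀ g (p i₀) (p′ i₀) (μ i₀) at λ j _ j≢ → off i₀ j (inj₂ j≢)))
  λ i _ i≢ → applyUpTo-cong (μ i) λ j _ → off i j (inj₁ i≢)

tab-extendRow : ∀ n μ μ′ (p p′ : ℕ → ℕ → A) i₀ {v} → μ′ i₀ ≡ suc (μ i₀) →
  (∀ i → i ≢ i₀ → μ′ i ≡ μ i) → p′ i₀ (μ i₀) ≡ v →
  (∀ i j → j < μ i → p′ i j ≡ p i j) →
  modifyAt i₀ (_++ [ v ]) (tab n μ p) ≡ tab n μ′ p′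
tab-extendRow n μ μ′ p p′ i₀ {v} μ-at μ-off refl p-old = modifyAt-applyUpTo i₀ _ _ _ n
  (begin
    applyUpTo (p′ i₀) (μ′ i₀)       ≡⟨ cong (applyUpTo (p′ i₀)) μ-at ⟩
    applyUpTo (p′ i₀) (suc (μ i₀))  ≡⟨ applyUpTo-∷ʳ (p′ i₀) (μ i₀) ⟨
    applyUpTo (p′ i₀) (μ i₀) ++ [ v ] ≡⟨ cong (_++ [ v ]) (applyUpTo-cong (μ i₀) (p-old i₀)) ⟩
    applyUpTo (p i₀) (μ i₀) ++ [ v ] ∎)
  λ i _ i≢ → trans (cong (applyUpTo (p′ i)) (μ-off i i≢)) (applyUpTo-cong (μ i) (p-old i))
  where open ≡-Reasoning

tab-newRow : ∀ n μ μ′ (p p′ : ℕ → ℕ → A) {v} → μ′ n ≡ 1 → (∀ i → i ≢ n → μ′ i ≡ μ i) →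
  p′ n 0 ≡ v → (∀ i j → j < μ i → p′ i j ≡ p i j) →
  tab n μ p ++ [ [ v ] ] ≡ tab (suc n) μ′ p′
tab-newRow n μ μ′ p p′ {v} μ-at μ-off refl p-old = begin
  tab n μ p ++ [ [ v ] ]     ≡⟨ cong (_++ [ [ v ] ]) (tab-cong n (λ i i<n → sym (μ-off i (<⇒≢ i<n)))
                                  λ i j i<n j<μ → sym (p-old i j (subst (j <_) (μ-off i (<⇒≢ i<n)) j<μ))) ⟩
  tab n μ′ p′ ++ [ [ v ] ]   ≡⟨ cong (λ k → tab n μ′ p′ ++ [ applyUpTo (p′ n) k ]) μ-at ⟨
  tab n μ′ p′ ++ [ applyUpTo (p′ n) (μ′ n) ] ≡⟨ applyUpTo-∷ʳ (λ i → applyUpTo (p′ i) (μ′ i)) n ⟩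
  tab (suc n) μ′ p′          ∎
  where open ≡-Reasoning

-- The test for increasing tableaux

all⁺ : ∀ (b : A → Bool) f n → (∀ i → i < n → T (b (f i))) → T (all b (applyUpTo f n))
all⁺ b f zero h = tt
all⁺ b f (suc n) h = ∧-intro (h 0 z<s) (all⁺ b (f ∘ suc) n λ i i<n → h (suc i) (s<s i<n))

all⁻ : ∀ (b : A → Bool) f n → T (all b (applyUpTo f n)) → ∀ i → i < n → T (b (f i))
all⁻ b f (suc n) t zero _ = proj₁ (∧-elim t)
all⁻ b f (suc n) t (suc i) (s<s i<n) = all⁻ b (f ∘ suc) n (proj₂ (∧-elim {b (f 0)} t)) i i<n

nonempty⁺ : ∀ f n → 0 < n → T (nonemptyB (applyUpTo f n))
nonempty⁺ f (suc n) _ = tt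

rowInc⁺ : ∀ f n → (∀ j → suc j < n → f j < f (suc j)) → T (rowIncB (applyUpTo f n))
rowInc⁺ f zero h = tt
rowInc⁺ f (suc zero) h = tt
rowInc⁺ f (suc (suc n)) h =
  ∧-intro (<⇒<ᵇ (h 0 (s<s z<s))) (rowInc⁺ (f ∘ suc) (suc n) λ j j<n → h (suc j) (s<s j<n))

rowInc⁻ : ∀ f n → T (rowIncB (applyUpTo f n)) → ∀ j → suc j < n → f j < f (suc j)
rowInc⁻ f (suc zero) t j (s<s ())
rowInc⁻ f (suc (suc n)) t zero _ = <ᵇ⇒< _ _ (proj₁ (∧-elim t))
rowInc⁻ f (suc (suc n)) t (suc j) (s<s j<n) =
  rowInc⁻ (f ∘ suc) (suc n) (proj₂ (∧-elim {f 0 <ᵇ f 1} t)) j j<n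

colOK⁺ : ∀ f g m n → n ≤ m → (∀ j → j < n → f j < g j) → T (colOKB (applyUpTo f m) (applyUpTo g n))
colOK⁺ f g zero zero _ h = tt
colOK⁺ f g (suc m) zero _ h = tt
colOK⁺ f g (suc m) (suc n) (s≤s n≤m) h =
  ∧-intro (<⇒<ᵇ (h 0 z<s)) (colOK⁺ (f ∘ suc) (g ∘ suc) m n n≤m λ j j<n → h (suc j) (s<s j<n))

colOK⁻ : ∀ f g m n → T (colOKB (applyUpTo f m) (applyUpTo g n)) → ∀ j → j < n → f j < g j
colOK⁻ f g (suc m) (suc n) t zero _ = <ᵇ⇒< _ _ (proj₁ (∧-elim t))
colOK⁻ f g (suc m) (suc n) t (suc j) (s<s j<n) =
  colOK⁻ (f ∘ suc) (g ∘ suc) m n (proj₂ (∧-elim {f 0 <ᵇ g 0} t)) j j<n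

colsOK⁺ : ∀ f n → (∀ i → suc i < n → T (colOKB (f i) (f (suc i)))) → T (colsOKB (applyUpTo f n))
colsOK⁺ f zero h = tt
colsOK⁺ f (suc zero) h = tt
colsOK⁺ f (suc (suc n)) h =
  ∧-intro (h 0 (s<s z<s)) (colsOK⁺ (f ∘ suc) (suc n) λ i i<n → h (suc i) (s<s i<n))

colsOK⁻ : ∀ f n → T (colsOKB (applyUpTo f n)) → ∀ i → suc i < n → T (colOKB (f i) (f (suc i)))
colsOK⁻ f (suc zero) t j (s<s ())
colsOK⁻ f (suc (suc n)) t zero _ = proj₁ (∧-elim t)
colsOK⁻ f (suc (suc n)) t (suc i) (s<s i<n) =
  colsOK⁻ (f ∘ suc) (suc n) (proj₂ (∧-elim {colOKB (f 0) (f 1)} t)) i i<n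

isIncreasing⁺ : ∀ n μ p → (∀ i → i < n → 0 < μ i) → (∀ i → suc i < n → μ (suc i) ≤ μ i) →
  (∀ i j → suc j < μ i → p i j < p i (suc j)) →
  (∀ i j → j < μ (suc i) → p i j < p (suc i) j) →
  isIncreasingB (tab n μ p) ≡ true
isIncreasing⁺ n μ p pos anti row col = T⇒≡true (∧-intro
  (all⁺ nonemptyB _ n λ i i<n → nonempty⁺ (p i) (μ i) (pos i i<n))
  (∧-intro (all⁺ rowIncB _ n λ i _ → rowInc⁺ (p i) (μ i) (row i))
    (colsOK⁺ _ n λ i i<n → colOK⁺ (p i) (p (suc i)) (μ i) (μ (suc i)) (anti i i<n) (col i))))

-- This direction and `isIncreasing⇒col` serve to refute the test, by exhibiting two equal
-- neighbours.
isIncreasing⇒row : ∀ n μ p → isIncreasingB (tab n μ p) ≡ true →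
  ∀ i j → i < n → suc j < μ i → p i j < p i (suc j)
isIncreasing⇒row n μ p t i j i<n = rowInc⁻ (p i) (μ i)
  (all⁻ rowIncB _ n (proj₁ (∧-elim (proj₂ (∧-elim {all nonemptyB (tab n μ p)} (≡true⇒T t))))) i i<n) j

isIncreasing⇒col : ∀ n μ p → isIncreasingB (tab n μ p) ≡ true →
  ∀ i j → suc i < n → j < μ (suc i) → p i j < p (suc i) j
isIncreasing⇒col n μ p t i j i<n = colOK⁻ (p i) (p (suc i)) (μ i) (μ (suc i))
  (colsOK⁻ _ n (proj₂ (∧-elim {all rowIncB (tab n μ p)}
    (proj₂ (∧-elim {all nonemptyB (tab n μ p)} (≡true⇒T t))))) i i<n) j

-- Insertion into one row

step⇒≤ : ∀ (f : ℕ → ℕ) → (∀ j → f j < f (suc j)) → ∀ {j k} → j ≤ k → f j ≤ f k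
step⇒≤ f step {j} {zero} z≤n = ≤-refl
step⇒≤ f step {j} {suc k} j≤1+k with m≤n⇒m<n∨m≡n j≤1+k
... | inj₁ (s≤s j≤k) = ≤-trans (step⇒≤ f step j≤k) (<⇒≤ (step k))
... | inj₂ refl = ≤-refl

step⇒< : ∀ (f : ℕ → ℕ) → (∀ j → f j < f (suc j)) → ∀ {j k} → j < k → f j < f k
step⇒< f step j<k = <-≤-trans (step _) (step⇒≤ f step j<k)

minGt-nothing : ∀ x f n → (∀ j → j < n → f j ≤ x) → minGt x (applyUpTo f n) ≡ nothing
minGt-nothing x f zero h = refl
minGt-nothing x f (suc n) h rewrite <ᵇ-false (h 0 z<s) =
  minGt-nothing x (f ∘ suc) n λ j j<n → h (suc j) (s<s j<n)

-- `minGt` takes a minimum over the whole row; this bound keeps the rest of an increasing row from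
-- undercutting the first entry found.
minGt-lower : ∀ x f n v → (∀ j → v ≤ f j) → ∀ z → minGt x (applyUpTo f n) ≡ just z → v ≤ z
minGt-lower x f (suc n) v h z e with x <ᵇ f 0 | minGt x (applyUpTo (f ∘ suc) n) in eq
... | false | _ = minGt-lower x (f ∘ suc) n v (h ∘ suc) z (trans eq e)
minGt-lower x f (suc n) v h z refl | true | nothing = h 0
minGt-lower x f (suc n) v h z refl | true | just z′ =
  ⊓-glb (h 0) (minGt-lower x (f ∘ suc) n v (h ∘ suc) z′ eq)

minGt-just : ∀ x f n k → (∀ j → f j < f (suc j)) → (∀ j → j < k → f j ≤ x) → k < n → x < f k →
  minGt x (applyUpTo f n) ≡ just (f k)
minGt-just x f (suc n) zero step h k<n x<fk rewrite <ᵇ-true x<fk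
  with minGt x (applyUpTo (f ∘ suc) n) in eq
... | nothing = refl
... | just z = cong just (m≤n⇒m⊓n≡m
  (minGt-lower x (f ∘ suc) n (f 0) (λ j → step⇒≤ f step z≤n) z eq))
minGt-just x f (suc n) (suc k) step h (s<s k<n) x<fk rewrite <ᵇ-false (h 0 z<s) =
  minGt-just x (f ∘ suc) n k (step ∘ suc) (λ j j<k → h (suc j) (s<s j<k)) k<n x<fk

indexOf-applyUpTo : ∀ f n k → (∀ j → f j < f (suc j)) → k < n → indexOf (f k) (applyUpTo f n) ≡ k
indexOf-applyUpTo f (suc n) zero step _ rewrite ≡ᵇ-true (refl {x = f 0}) = refl
indexOf-applyUpTo f (suc n) (suc k) step (s<s k<n)
  rewrite ≡ᵇ-false (<⇒≢ (step⇒< f step {0} {suc k} z<s)) =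
  cong suc (indexOf-applyUpTo (f ∘ suc) n k (step ∘ suc) k<n)

module _ (R : List ℕ) (rest : List (List ℕ)) {r x : ℕ} (y : ℕ) {P : Tableau} (Q : SVTableau) where

  -- The branches of `insertRow` as equations guarded by the outcomes of its tests. The resulting
  -- tableaux are variables, so that they can be supplied in the form `tab`.
  insertRow-append : ∀ {P′ Q′} → minGt x R ≡ nothing →
    modifyAt r (_++ [ x ]) P ≡ P′ → isIncreasingB P′ ≡ true →
    modifyAt r (_++ [ [ y ] ]) Q ≡ Q′ → insertRow (R ∷ rest) r x y P Q ≡ (P′ , Q′)
  insertRow-append gt refl inc refl rewrite gt | inc = refl

  insertRow-corner : ∀ {P′ Q′} → minGt x R ≡ nothing →
    modifyAt r (_++ [ x ]) P ≡ P′ → isIncreasingB P′ ≡ false →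
    addToCorner (length R ∸ 1) y Q ≡ Q′ → insertRow (R ∷ rest) r x y P Q ≡ (P , Q′)
  insertRow-corner gt refl inc refl rewrite gt | inc = refl

  insertRow-replace : ∀ {P′ z} → minGt x R ≡ just z →
    modifyAt r (modifyAt (indexOf z R) (λ _ → x)) P ≡ P′ → isIncreasingB P′ ≡ true →
    insertRow (R ∷ rest) r x y P Q ≡ insertRow rest (suc r) z y P′ Q
  insertRow-replace gt refl inc rewrite gt | inc = refl

  insertRow-keep : ∀ {P′ z} → minGt x R ≡ just z →
    modifyAt r (modifyAt (indexOf z R) (λ _ → x)) P ≡ P′ → isIncreasingB P′ ≡ false →
    insertRow (R ∷ rest) r x y P Q ≡ insertRow rest (suc r) z y P Q
  insertRow-keep gt refl inc rewrite gt | inc = refl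

insertRow-top : ∀ {r x y P Q P′ Q′} → P ++ [ [ x ] ] ≡ P′ → isIncreasingB P′ ≡ true →
  Q ++ [ [ [ y ] ] ] ≡ Q′ → insertRow [] r x y P Q ≡ (P′ , Q′)
insertRow-top refl inc refl rewrite inc = refl

-- The corner cell of a column.

-- The metavariable in `scan` is solved by the local loop of `topRowWithCol`, which has no name outside Defs.
mutual
  scan : ℕ → ℕ → SVTableau → Maybe ℕ → Maybe ℕ
  scan = _

  topRowWithCol≡scan : ∀ c Q → topRowWithCol c Q ≡ scan c 0 Q nothing
  topRowWithCol≡scan c Q with 0 | nothing {A = ℕ}
  ... | r | acc = refl

scan-short : ∀ c r f n acc → (∀ i → length (f i) ≤ c) → scan c r (applyUpTo f n) acc ≡ acc
scan-short c r f zero acc h = refl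
scan-short c r f (suc n) acc h rewrite <ᵇ-false (h 0) = scan-short c (suc r) (f ∘ suc) n acc (h ∘ suc)

-- Every hit overwrites the accumulator, so the last row that is long enough wins, whatever the
-- earlier rows do.
scan-corner : ∀ c r f n k acc → k < n → c < length (f k) → (∀ i → k < i → length (f i) ≤ c) →
  scan c r (applyUpTo f n) acc ≡ just (r + k)
scan-corner c r f (suc n) zero acc _ long short rewrite <ᵇ-true long =
  trans (scan-short c (suc r) (f ∘ suc) n (just r) λ i → short (suc i) z<s) (cong just (sym (+-identityʳ r)))
scan-corner c r f (suc n) (suc k) acc (s<s k<n) long short =
  trans (scan-corner c (suc r) (f ∘ suc) n k _ k<n long λ i k<i → short (suc i) (s<s k<i))
    (cong just (sym (+-suc r k)))

addToCorner-tab : ∀ n μ (q q′ : ℕ → ℕ → List ℕ) y i₀ j₀ → i₀ < n → j₀ < μ i₀ → (∀ i → i₀ < i → μ i ≤ j₀) →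
  q′ i₀ j₀ ≡ insertSet y (q i₀ j₀) → (∀ i j → i ≢ i₀ ⊎ j ≢ j₀ → q′ i j ≡ q i j) →
  addToCorner j₀ y (tab n μ q) ≡ tab n μ q′
addToCorner-tab n μ q q′ y i₀ j₀ i₀<n j₀<μ short at off
  rewrite trans (topRowWithCol≡scan j₀ (tab n μ q)) (scan-corner j₀ 0 _ n i₀ nothing i₀<n
    (subst (j₀ <_) (sym (length-applyUpTo (q i₀) (μ i₀))) j₀<μ)
    λ i i₀<i → subst (_≤ j₀) (sym (length-applyUpTo (q i) (μ i))) (short i i₀<i)) =
  tab-modifyAt n μ q q′ i₀ j₀ (insertSet y) at off

-- The insertion tableau of a given shape

-- H and μ are the column heights and row lengths of the shape (0-indexed); cell (i, j) of the insertion
-- tableau holds i + a j, so that the top entry of column j is always ℓ + j.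
record Shape (ℓ : ℕ) : Set where
  field
    H μ a : ℕ → ℕ
    to : ∀ {i j} → j < μ i → i < H j
    from : ∀ {i j} → i < H j → j < μ i
    a+H : ∀ j → a j + H j ≡ suc (ℓ + j)

  value : ℕ → ℕ → ℕ
  value i j = i + a j

  -- `to` and `from` make `H` and `μ` conjugate. A cell of column `k` at height `H j` would put a
  -- cell at that height into column `j` as well, where there is none.
  H-anti : ∀ {j k} → j ≤ k → H k ≤ H j
  H-anti j≤k = ≮⇒≥ λ Hj<Hk → n≮n _ (to (≤-<-trans j≤k (from Hj<Hk)))

  μ-anti : ∀ {i k} → i ≤ k → μ k ≤ μ i
  μ-anti i≤k = ≮⇒≥ λ μi<μk → n≮n _ (from (≤-<-trans i≤k (to μi<μk)))

  -- The sum of `a` and `H` grows by one per column while `H` does not grow.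
  a-step : ∀ j → a j < a (suc j)
  a-step j = +-cancelʳ-< (H j) (a j) (a (suc j)) (begin-strict
    a j + H j              ≡⟨ a+H j ⟩
    suc (ℓ + j)            <⟨ n<1+n _ ⟩
    suc (suc (ℓ + j))      ≡⟨ cong suc (+-suc ℓ j) ⟨
    suc (ℓ + suc j)        ≡⟨ a+H (suc j) ⟨
    a (suc j) + H (suc j)  ≤⟨ +-monoʳ-≤ (a (suc j)) (H-anti (n≤1+n j)) ⟩
    a (suc j) + H j        ∎)
    where open ≤-Reasoning

  value-row : ∀ i j → value i j < value i (suc j)
  value-row i j = +-monoʳ-< i (a-step j)

  value-increasing : isIncreasingB (tab (H 0) μ value) ≡ true
  value-increasing = isIncreasing⁺ (H 0) μ value (λ _ → from) (λ i _ → μ-anti (n≤1+n i))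
    (λ i j _ → value-row i j) (λ _ _ _ → ≤-refl)

upd₂ : (ℕ → ℕ → A) → ℕ → ℕ → A → ℕ → ℕ → A
upd₂ f i₀ j₀ v = upd f i₀ (upd (f i₀) j₀ v)

upd₂-same : ∀ (f : ℕ → ℕ → A) i₀ j₀ {v} → upd₂ f i₀ j₀ v i₀ j₀ ≡ v
upd₂-same f i₀ j₀ {v} = trans (cong (λ g → g j₀) (upd-same f i₀)) (upd-same (f i₀) j₀)

upd₂-other : ∀ (f : ℕ → ℕ → A) i₀ j₀ {v} i j → i ≢ i₀ ⊎ j ≢ j₀ → upd₂ f i₀ j₀ v i j ≡ f i j
upd₂-other f i₀ j₀ i j d with i ≟ i₀
upd₂-other f i₀ j₀ i j d | no _ = refl
upd₂-other f i₀ j₀ i j (inj₁ i≢) | yes i≡ = contradiction i≡ i≢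
upd₂-other f i₀ j₀ i j (inj₂ j≢) | yes refl = upd-other (f i₀) j₀ j≢

-- Insertion at an addable corner.

module AddCell {ℓ} (S : Shape ℓ) (i₀ j₀ x : ℕ) (content : x + i₀ ≡ ℓ + j₀)
  (Hj₀ : Shape.H S j₀ ≡ i₀) (left : ∀ j → j < j₀ → i₀ < Shape.H S j) where
  open Shape S

  -- This makes the insertion lower column `j₀` by exactly one: in row `r` the letter `r + x`
  -- displaces `suc (r + x)`, which is the letter for the next row.
  a-j₀ : a j₀ ≡ suc x
  a-j₀ = +-cancelʳ-≡ i₀ (a j₀) (suc x) (begin
    a j₀ + i₀     ≡⟨ cong (a j₀ +_) Hj₀ ⟨
    a j₀ + H j₀   ≡⟨ a+H j₀ ⟩
    suc (ℓ + j₀)  ≡⟨ cong suc content ⟨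
    suc x + i₀    ∎)
    where open ≡-Reasoning

  -- A column further left is taller than `i₀` and has a smaller top entry, so its bottom entry is
  -- below `x`. Hence the letter passes all these columns in every row.
  a<x : ∀ j → j < j₀ → a j < x
  a<x j j<j₀ = +-cancelʳ-< (suc i₀) (a j) x (begin-strict
    a j + suc i₀  ≤⟨ +-monoʳ-≤ (a j) (left j j<j₀) ⟩
    a j + H j     ≡⟨ a+H j ⟩
    suc (ℓ + j)   <⟨ s<s (+-monoʳ-< ℓ j<j₀) ⟩
    suc (ℓ + j₀)  ≡⟨ cong suc content ⟨
    suc (x + i₀)  ≡⟨ +-suc x i₀ ⟨
    x + suc i₀    ∎)
    where open ≤-Reasoning

  μ-i₀ : μ i₀ ≡ j₀
  μ-i₀ = ≤-antisym (≮⇒≥ λ j₀<μ → n≮n i₀ (subst (i₀ <_) Hj₀ (to j₀<μ)))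
    (≮⇒≥ λ μ<j₀ → n≮n _ (from (left _ μ<j₀)))

  H′ μ′ a′ : ℕ → ℕ
  H′ = upd H j₀ (suc i₀)
  μ′ = upd μ i₀ (suc j₀)
  a′ = upd a j₀ x

  private
    to′ : ∀ {i j} → j < μ′ i → i < H′ j
    to′ {i} {j} h with i ≟ i₀ | j ≟ j₀
    ... | yes refl | yes refl = n<1+n i₀
    ... | yes refl | no j≢ = left j (≤∧≢⇒< (≤-pred h) j≢)
    ... | no _ | yes refl = m<n⇒m<1+n (subst (i <_) Hj₀ (to h))
    ... | no _ | no _ = to h

    from′ : ∀ {i j} → i < H′ j → j < μ′ i
    from′ {i} {j} h with i ≟ i₀ | j ≟ j₀
    ... | yes refl | yes refl = n<1+n j₀
    ... | yes refl | no _ = m<n⇒m<1+n (subst (j <_) μ-i₀ (from h))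
    ... | no i≢ | yes refl = from (subst (i <_) (sym Hj₀) (≤∧≢⇒< (≤-pred h) i≢))
    ... | no _ | no _ = from h

    a′+H′ : ∀ j → a′ j + H′ j ≡ suc (ℓ + j)
    a′+H′ j with j ≟ j₀
    ... | yes refl = trans (+-suc x i₀) (cong suc content)
    ... | no _ = a+H j

  S′ : Shape ℓ
  S′ = record { H = H′ ; μ = μ′ ; a = a′ ; to = to′ ; from = from′ ; a+H = a′+H′ }

  μ′-i₀ : μ′ i₀ ≡ suc (μ i₀)
  μ′-i₀ = trans (upd-same μ i₀) (cong suc (sym μ-i₀))

  μ′-other : ∀ i → i ≢ i₀ → μ′ i ≡ μ i
  μ′-other i = upd-other μ i₀

  -- The intermediate tableaux: column j₀ has already been lowered by one in the rows below r.
  record Lowered (r : ℕ) (p : ℕ → ℕ → ℕ) : Set where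
    field
      below : ∀ i → i < r → p i j₀ ≡ i + x
      above : ∀ i → r ≤ i → p i j₀ ≡ value i j₀
      other : ∀ i j → j ≢ j₀ → p i j ≡ value i j

    -- Together with `upper` this bounds the entries on both sides of row `r` at once, so that `row`
    -- needs no case distinction on `r`.
    lower : ∀ i → i + x ≤ p i j₀
    lower i with i <? r
    ... | yes i<r = ≤-reflexive (sym (below i i<r))
    ... | no i≮r = subst (i + x ≤_) (sym (above i (≮⇒≥ i≮r)))
      (+-monoʳ-≤ i (subst (x ≤_) (sym a-j₀) (n≤1+n x)))

    upper : ∀ i j → p i j ≤ value i j
    upper i j with j ≟ j₀ | i <? r
    ... | no j≢ | _ = ≤-reflexive (other i j j≢)
    ... | yes refl | no i≮r = ≤-reflexive (above i (≮⇒≥ i≮r))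
    ... | yes refl | yes i<r = subst (_≤ value i j₀) (sym (below i i<r))
      (+-monoʳ-≤ i (subst (x ≤_) (sym a-j₀) (n≤1+n x)))

    row : ∀ i j → p i j < p i (suc j)
    row i j with suc j ≟ j₀
    -- The left neighbour is smaller even than the lowered entry.
    ... | yes refl = ≤-<-trans (upper i j) (<-≤-trans (+-monoʳ-< i (a<x j ≤-refl)) (lower i))
    ... | no 1+j≢ = ≤-<-trans (upper i j) (subst (value i j <_) (sym (other i (suc j) 1+j≢)) (value-row i j))

    col : ∀ i j → p i j < p (suc i) j
    col i j with j ≟ j₀ | i <? r
    ... | no j≢ | _ = subst (p i j <_) (sym (other (suc i) j j≢)) (s≤s (upper i j))
    -- If `suc i` equals `r`, the column jumps by two here; `lower` covers this as well.
    ... | yes refl | yes i<r = subst (_< p (suc i) j₀) (sym (below i i<r)) (lower (suc i))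
    ... | yes refl | no i≮r = subst (p i j₀ <_) (sym (above (suc i) (m≤n⇒m≤1+n (≮⇒≥ i≮r)))) (s≤s (upper i j₀))

    increasing : isIncreasingB (tab (H 0) μ p) ≡ true
    increasing = isIncreasing⁺ (H 0) μ p (λ _ → from) (λ i _ → μ-anti (n≤1+n i))
      (λ i j _ → row i j) (λ i j _ → col i j)

  lowered-zero : Lowered 0 value
  lowered-zero = record { below = λ _ () ; above = λ _ _ → refl ; other = λ _ _ _ → refl }

  lowered-suc : ∀ {r p} → Lowered r p → Lowered (suc r) (upd₂ p r j₀ (r + x))
  lowered-suc {r} {p} L = record
    { below = below′
    ; above = λ i r<i → trans (upd₂-other p r j₀ i j₀ (inj₁ (>⇒≢ r<i))) (above i (<⇒≤ r<i))
    ; other = λ i j j≢ → trans (upd₂-other p r j₀ i j (inj₂ j≢)) (other i j j≢) }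
    where
    open Lowered L
    below′ : ∀ i → i < suc r → upd₂ p r j₀ (r + x) i j₀ ≡ i + x
    below′ i i≤r with i ≟ r
    ... | yes refl = upd-same (p r) j₀
    ... | no i≢r = below i (≤∧≢⇒< (≤-pred i≤r) i≢r)

  -- The old cells of column `j₀` are those in the rows below `i₀`, so all of them have been
  -- lowered.
  lowered-final : ∀ {p} → Lowered i₀ p → ∀ i j → j < μ i → Shape.value S′ i j ≡ p i j
  lowered-final L i j j<μ with j ≟ j₀
  ... | yes refl = sym (Lowered.below L i (subst (i <_) Hj₀ (to j<μ)))
  ... | no j≢ = sym (Lowered.other L i j j≢)

  module _ (y : ℕ) (q q′ : ℕ → ℕ → List ℕ) (new : q′ i₀ j₀ ≡ [ y ])
    (old : ∀ i j → j < μ i → q′ i j ≡ q i j) where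

    -- Induction on the number `d` of rows not yet read. These come from the original tableau, while
    -- `p` contains the changes made so far; the two agree from row `r` on.
    insert-from : ∀ d r p rows → r + d ≡ H 0 → r ≤ i₀ → Lowered r p →
      (∀ k → rows k ≡ applyUpTo (value (r + k)) (μ (r + k))) →
      insertRow (applyUpTo rows d) r (r + x) y (tab (H 0) μ p) (tab (H 0) μ q)
        ≡ (tab (H′ 0) μ′ (Shape.value S′) , tab (H′ 0) μ′ q′)
    insert-from zero r p rows r+d≡H r≤i₀ L rows≡ = result
      where
      -- With no row left, the new cell opens a row of its own. By `left` this forces `j₀` to be 0,
      -- and then `i₀` is the number of rows.
      H0≤i₀ : H 0 ≤ i₀
      H0≤i₀ = subst (_≤ i₀) (trans (sym (+-identityʳ r)) r+d≡H) r≤i₀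

      j₀≡0 : j₀ ≡ 0
      j₀≡0 = n≤0⇒n≡0 (≮⇒≥ λ 0<j₀ → <⇒≱ (left 0 0<j₀) H0≤i₀)

      H0≡i₀ : H 0 ≡ i₀
      H0≡i₀ = subst (λ j → H j ≡ i₀) j₀≡0 Hj₀

      r≡i₀ : r ≡ i₀
      r≡i₀ = trans (trans (sym (+-identityʳ r)) r+d≡H) H0≡i₀

      H′0 : H′ 0 ≡ suc (H 0)
      H′0 = trans (subst (λ j → upd H j (suc i₀) 0 ≡ suc i₀) (sym j₀≡0) (upd-same H 0)) (cong suc (sym H0≡i₀))

      -- The entry type is arbitrary so that the insertion and the recording tableau are treated
      -- alike.
      newRow : ∀ {B : Set} {p p′ : ℕ → ℕ → B} {v} → p′ i₀ j₀ ≡ v → (∀ i j → j < μ i → p′ i j ≡ p i j) →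
        tab (H 0) μ p ++ [ [ v ] ] ≡ tab (H′ 0) μ′ p′
      newRow {p = p} {p′} at off = trans
        (tab-newRow (H 0) μ μ′ p p′
          (trans (cong μ′ H0≡i₀) (trans (upd-same μ i₀) (cong suc j₀≡0)))
          (λ i i≢ → μ′-other i λ i≡ → i≢ (trans i≡ (sym H0≡i₀)))
          (trans (cong₂ p′ H0≡i₀ (sym j₀≡0)) at) off)
        (cong (λ n → tab n μ′ p′) (sym H′0))

      result : insertRow [] r (r + x) y (tab (H 0) μ p) (tab (H 0) μ q)
        ≡ (tab (H′ 0) μ′ (Shape.value S′) , tab (H′ 0) μ′ q′)
      result = insertRow-top {r}
        (newRow (trans (cong (i₀ +_) (upd-same a j₀)) (cong (_+ x) (sym r≡i₀)))
          (lowered-final (subst (λ r → Lowered r p) r≡i₀ L)))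
        (Shape.value-increasing S′) (newRow new old)
    insert-from (suc d) r p rows r+d≡H r≤i₀ L rows≡
      rewrite trans (rows≡ 0) (cong (λ r → applyUpTo (value r) (μ r)) (+-identityʳ r))
      with m≤n⇒m<n∨m≡n r≤i₀
    ... | inj₁ r<i₀ = trans
      (insertRow-replace (applyUpTo (value r) (μ r)) (applyUpTo (rows ∘ suc) d) y (tab (H 0) μ q) {P′ = tab (H 0) μ p′} gt
        (trans (cong (λ k → modifyAt r (modifyAt k (λ _ → r + x)) (tab (H 0) μ p))
                  (indexOf-applyUpTo (value r) (μ r) j₀ (value-row r) j₀<μ))
          (tab-modifyAt (H 0) μ p p′ r j₀ (λ _ → r + x) (upd₂-same p r j₀) (upd₂-other p r j₀)))
        (Lowered.increasing L′))
      (trans (cong (λ z → insertRow (applyUpTo (rows ∘ suc) d) (suc r) z y (tab (H 0) μ p′) (tab (H 0) μ q))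
               value-j₀)
        (insert-from d (suc r) p′ (rows ∘ suc) (trans (sym (+-suc r d)) r+d≡H) r<i₀ L′
          λ k → trans (rows≡ (suc k)) (cong (λ i → applyUpTo (value i) (μ i)) (+-suc r k))))
      where
      p′ = upd₂ p r j₀ (r + x)
      L′ = lowered-suc L
      j₀<μ : j₀ < μ r
      j₀<μ = from (subst (r <_) (sym Hj₀) r<i₀)
      -- The right side is definitionally `suc r + x`, the letter that the induction hypothesis
      -- inserts into the next row.
      value-j₀ : value r j₀ ≡ suc (r + x)
      value-j₀ = trans (cong (r +_) a-j₀) (+-suc r x)
      gt : minGt (r + x) (applyUpTo (value r) (μ r)) ≡ just (value r j₀)
      gt = minGt-just (r + x) (value r) (μ r) j₀ (value-row r)
        (λ j j<j₀ → +-monoʳ-≤ r (<⇒≤ (a<x j j<j₀))) j₀<μ (≤-reflexive (sym value-j₀))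
    ... | inj₂ refl = insertRow-append (applyUpTo (value r) (μ r)) (applyUpTo (rows ∘ suc) d) y (tab (H 0) μ q)
      (minGt-nothing (r + x) (value r) (μ r)
        λ j j<μ → +-monoʳ-≤ r (<⇒≤ (a<x j (subst (j <_) μ-i₀ j<μ))))
      (extend (cong (r +_) (upd-same a j₀)) (lowered-final L))
      (Shape.value-increasing S′)
      (extend new old)
      where
      r<H0 : r < H 0
      r<H0 = subst (r <_) r+d≡H (m<m+n r z<s)
      -- Row `r` already exists, so the new cell is not in column 0 and the number of rows stays the
      -- same.
      H′0 : H′ 0 ≡ H 0
      H′0 = upd-other H j₀ λ 0≡j₀ → n≮n r (subst (r <_) (trans (cong H 0≡j₀) Hj₀) r<H0)
      extend : ∀ {B : Set} {p p′ : ℕ → ℕ → B} {v} → p′ r j₀ ≡ v → (∀ i j → j < μ i → p′ i j ≡ p i j) →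
        modifyAt r (_++ [ v ]) (tab (H 0) μ p) ≡ tab (H′ 0) μ′ p′
      extend {p = p} {p′} at off = trans
        (tab-extendRow (H 0) μ μ′ p p′ r μ′-i₀ μ′-other (trans (cong (p′ r) μ-i₀) at) off)
        (cong (λ n → tab n μ′ p′) (sym H′0))

    insert : insertRow (tab (H 0) μ value) 0 x y (tab (H 0) μ value) (tab (H 0) μ q)
      ≡ (tab (H′ 0) μ′ (Shape.value S′) , tab (H′ 0) μ′ q′)
    insert = insert-from (H 0) 0 value _ refl z≤n lowered-zero λ _ → refl

-- Insertion at a removable corner.

module MarkCorner {ℓ} (S : Shape ℓ) (i₀ j₀ x : ℕ) (content : x + i₀ ≡ ℓ + j₀)
  (Hj₀ : Shape.H S j₀ ≡ suc i₀) (right : Shape.H S (suc j₀) ≤ i₀)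
  (y : ℕ) (q q′ : ℕ → ℕ → List ℕ) (at : q′ i₀ j₀ ≡ insertSet y (q i₀ j₀))
  (off : ∀ i j → i ≢ i₀ ⊎ j ≢ j₀ → q′ i j ≡ q i j) where
  open Shape S

  -- Column `j₀` is one cell taller than at an addable corner, so the letter equals its bottom entry
  -- instead of falling one short.
  a-j₀ : a j₀ ≡ x
  a-j₀ = +-cancelʳ-≡ (suc i₀) (a j₀) x (begin
    a j₀ + suc i₀ ≡⟨ cong (a j₀ +_) Hj₀ ⟨
    a j₀ + H j₀   ≡⟨ a+H j₀ ⟩
    suc (ℓ + j₀)  ≡⟨ cong suc content ⟨
    suc (x + i₀)  ≡⟨ +-suc x i₀ ⟨
    x + suc i₀    ∎)
    where open ≡-Reasoning

  -- The letter arriving at row r. It always equals an entry of P that blocks it: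
  -- its left neighbour in row 0, the cell below its place in the other rows.
  letter : ℕ → ℕ
  letter zero = a j₀
  letter (suc r) = value r (suc j₀)

  -- With `letter<value`, this places the first entry exceeding the letter in column `suc j₀`, in
  -- every row that reaches it.
  value≤letter : ∀ r j → j ≤ j₀ → value r j ≤ letter r
  value≤letter zero j j≤j₀ = step⇒≤ a a-step j≤j₀
  value≤letter (suc r) j j≤j₀ = subst (_≤ value r (suc j₀)) (+-suc r (a j))
    (+-monoʳ-≤ r (step⇒< a a-step (s≤s j≤j₀)))

  letter<value : ∀ r → letter r < value r (suc j₀)
  letter<value zero = a-step j₀
  letter<value (suc r) = ≤-refl

  -- The lengths `μ₁` are left free because the test fails for the same reason whether the letter
  -- replaces an entry or extends the row.
  blocked : ∀ n μ₁ p r → r < n → suc j₀ < μ₁ r → p r (suc j₀) ≡ letter r →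
    (∀ i j → i ≢ r ⊎ j ≢ suc j₀ → p i j ≡ value i j) → isIncreasingB (tab n μ₁ p) ≡ false
  blocked n μ₁ p zero r<n 1+j₀<μ here≡ else≡ = ¬true⇒false λ inc → n≮n (a j₀)
    (subst (_< a j₀) (else≡ 0 j₀ (inj₂ (<⇒≢ (n<1+n j₀))))
      (subst (p 0 j₀ <_) here≡ (isIncreasing⇒row n μ₁ p inc 0 j₀ r<n 1+j₀<μ)))
  blocked n μ₁ p (suc r) r<n 1+j₀<μ here≡ else≡ = ¬true⇒false λ inc → n≮n (value r (suc j₀))
    (subst (_< value r (suc j₀)) (else≡ r (suc j₀) (inj₁ (<⇒≢ (n<1+n r))))
      (subst (p r (suc j₀) <_) here≡ (isIncreasing⇒col n μ₁ p inc r (suc j₀) r<n 1+j₀<μ)))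

  j₀<μ : ∀ {r} → r ≤ i₀ → j₀ < μ r
  j₀<μ r≤i₀ = from (subst (_ <_) (sym Hj₀) (s≤s r≤i₀))

  i₀<H0 : i₀ < H 0
  i₀<H0 = ≤-trans (≤-reflexive (sym Hj₀)) (H-anti z≤n)

  p′ : ℕ → ℕ → ℕ → ℕ
  p′ r = upd₂ value r (suc j₀) (letter r)

  p′-at : ∀ r → p′ r r (suc j₀) ≡ letter r
  p′-at r = upd₂-same value r (suc j₀)

  p′-off : ∀ r i j → i ≢ r ⊎ j ≢ suc j₀ → p′ r i j ≡ value i j
  p′-off r = upd₂-other value r (suc j₀)

  -- The recursion stops at row `H (suc j₀)`, the first that ends in column `j₀`. By `right` this
  -- row is not above row `i₀`, so the rows do not run out before it.
  insert-from : ∀ d r rows → r + d ≡ H 0 → r ≤ H (suc j₀) →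
    (∀ k → rows k ≡ applyUpTo (value (r + k)) (μ (r + k))) →
    insertRow (applyUpTo rows d) r (letter r) y (tab (H 0) μ value) (tab (H 0) μ q)
      ≡ (tab (H 0) μ value , tab (H 0) μ q′)
  insert-from zero r rows r+d≡H r≤ rows≡ = contradiction
    (subst (_≤ i₀) (trans (sym (+-identityʳ r)) r+d≡H) (≤-trans r≤ right)) (<⇒≱ i₀<H0)
  insert-from (suc d) r rows r+d≡H r≤ rows≡
    rewrite trans (rows≡ 0) (cong (λ r → applyUpTo (value r) (μ r)) (+-identityʳ r))
    with m≤n⇒m<n∨m≡n r≤
  ... | inj₁ r<H = trans
    (insertRow-keep (applyUpTo (value r) (μ r)) (applyUpTo (rows ∘ suc) d) y (tab (H 0) μ q)
      (minGt-just (letter r) (value r) (μ r) (suc j₀) (value-row r)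
        (λ j j≤j₀ → value≤letter r j (≤-pred j≤j₀)) (from r<H) (letter<value r))
      (trans (cong (λ k → modifyAt r (modifyAt k (λ _ → letter r)) (tab (H 0) μ value))
                (indexOf-applyUpTo (value r) (μ r) (suc j₀) (value-row r) (from r<H)))
        (tab-modifyAt (H 0) μ value (p′ r) r (suc j₀) (λ _ → letter r) (p′-at r) (p′-off r)))
      (blocked (H 0) μ (p′ r) r (≤-<-trans (≤-trans r≤ right) i₀<H0) (from r<H) (p′-at r) (p′-off r)))
    (insert-from d (suc r) (rows ∘ suc) (trans (sym (+-suc r d)) r+d≡H) r<H
      λ k → trans (rows≡ (suc k)) (cong (λ i → applyUpTo (value i) (μ i)) (+-suc r k)))
  ... | inj₂ r≡H = insertRow-corner (applyUpTo (value r) (μ r)) (applyUpTo (rows ∘ suc) d) y (tab (H 0) μ q)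
    (minGt-nothing (letter r) (value r) (μ r)
      λ j j<μ → value≤letter r j (≤-pred (subst (j <_) μ-r j<μ)))
    (tab-extendRow (H 0) μ μ₁ value (p′ r) r (trans (upd-same μ r) (cong suc (sym μ-r)))
      (λ i → upd-other μ r) (trans (cong (p′ r r) μ-r) (p′-at r)) p′-old)
    (blocked (H 0) μ₁ (p′ r) r (≤-<-trans r≤i₀ i₀<H0) (subst (suc j₀ <_) (sym (upd-same μ r)) ≤-refl)
      (p′-at r) (p′-off r))
    -- Row `r` has length `suc j₀`, so the letter is recorded in column `j₀`, whose top cell is in
    -- row `i₀`, possibly above row `r`.
    (trans (cong (λ n → addToCorner (n ∸ 1) y (tab (H 0) μ q)) (trans (length-applyUpTo (value r) (μ r)) μ-r))
      (addToCorner-tab (H 0) μ q q′ y i₀ j₀ i₀<H0 (j₀<μ ≤-refl)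
        (λ i i₀<i → ≮⇒≥ λ j₀<μi → <⇒≱ i₀<i (≤-pred (subst (i <_) Hj₀ (to j₀<μi)))) at off))
    where
    r≤i₀ : r ≤ i₀
    r≤i₀ = ≤-trans r≤ right
    μ-r : μ r ≡ suc j₀
    μ-r = ≤-antisym (≮⇒≥ λ 1+j₀<μ → <⇒≢ (to 1+j₀<μ) r≡H) (j₀<μ r≤i₀)
    μ₁ = upd μ r (suc (suc j₀))
    p′-old : ∀ i j → j < μ i → p′ r i j ≡ value i j
    p′-old i j j<μ with i ≟ r
    ... | no i≢r = refl
    ... | yes refl = upd-other (value r) (suc j₀) (<⇒≢ (subst (j <_) μ-r j<μ))

  insert : insertRow (tab (H 0) μ value) 0 x y (tab (H 0) μ value) (tab (H 0) μ q)
    ≡ (tab (H 0) μ value , tab (H 0) μ q′)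
  insert = subst (λ x → insertRow (tab (H 0) μ value) 0 x y (tab (H 0) μ value) (tab (H 0) μ q)
    ≡ (tab (H 0) μ value , tab (H 0) μ q′)) a-j₀ (insert-from (H 0) 0 _ refl z≤n λ _ → refl)

-- The invariant of the insertion.

-- `full` and `empty` make the shape the set of nonempty cells of `q`, so that corner conditions can
-- be read off from `q`.
record State (ℓ : ℕ) (q : ℕ → ℕ → List ℕ) (s : Tableau × SVTableau) : Set where
  field
    shp : Shape ℓ
  open Shape shp public
  field
    full : ∀ {i j} → i < H j → q i j ≢ []
    empty : ∀ {i j} → H j ≤ i → q i j ≡ []
    tableaux : s ≡ (tab (H 0) μ value , tab (H 0) μ q)

State-cong : ∀ {ℓ q q′ s} → (∀ i j → q i j ≡ q′ i j) → State ℓ q s → State ℓ q′ s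
State-cong q≡ st = record
  { shp = shp
  ; full = λ i<H e → full i<H (trans (q≡ _ _) e)
  ; empty = λ H≤i → trans (sym (q≡ _ _)) (empty H≤i)
  ; tableaux = trans tableaux (cong (tab (H 0) μ value ,_) (tab-cong (H 0) (λ _ _ → refl) λ i j _ _ → q≡ i j)) }
  where open State st

State-init : ∀ {ℓ q} → (∀ i j → q i j ≡ []) → State ℓ q ([] , [])
State-init {ℓ} q≡[] = record
  { shp = record { H = λ _ → 0 ; μ = λ _ → 0 ; a = λ j → suc (ℓ + j) ; to = λ () ; from = λ ()
                 ; a+H = λ j → +-identityʳ _ }
  ; full = λ () ; empty = λ _ → q≡[] _ _ ; tableaux = refl }

insertSet≢[] : ∀ y s → insertSet y s ≢ []
insertSet≢[] y [] ()
insertSet≢[] y (a ∷ s) with y <ᵇ a | y ≡ᵇ a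
... | true | _ = λ ()
... | false | true = λ ()
... | false | false = λ ()

sameCell? : ∀ i j i₀ j₀ → (i ≡ i₀ × j ≡ j₀) ⊎ (i ≢ i₀ ⊎ j ≢ j₀)
sameCell? i j i₀ j₀ with i ≟ i₀ | j ≟ j₀
... | yes p | yes q = inj₁ (p , q)
... | no p | _ = inj₂ (inj₁ p)
... | yes _ | no q = inj₂ (inj₂ q)

-- The conditions on the four neighbours say that (`i₀`, `j₀`) is an addable or a removable corner;
-- which one depends on whether the cell is already filled.
State-step : ∀ {ℓ q s} → State ℓ q s → ∀ i₀ j₀ x y q′ → x + i₀ ≡ ℓ + j₀ →
  q′ i₀ j₀ ≡ insertSet y (q i₀ j₀) → (∀ i j → i ≢ i₀ ⊎ j ≢ j₀ → q′ i j ≡ q i j) →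
  (∀ j → j < j₀ → q i₀ j ≢ []) → (∀ i → i < i₀ → q i j₀ ≢ []) →
  q (suc i₀) j₀ ≡ [] → (q i₀ (suc j₀) ≡ []) →
  State ℓ q′ (heckeStep s (y , x))
State-step {ℓ} {q} {s} st i₀ j₀ x y q′ content at off left below above right
  with i₀ <? State.H st j₀
... | yes i₀<H = record { shp = shp ; full = full′ ; empty = empty′
  ; tableaux = trans (cong (λ s → heckeStep s (y , x)) tableaux) insert }
  where
  open State st
  Hj₀ : H j₀ ≡ suc i₀
  Hj₀ = ≤-antisym (≮⇒≥ λ 1+i₀<H → full 1+i₀<H above) i₀<H
  open MarkCorner shp i₀ j₀ x content Hj₀ (≮⇒≥ λ i₀<H′ → full i₀<H′ right) y q q′ at off
  full′ : ∀ {i j} → i < H j → q′ i j ≢ []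
  full′ {i} {j} i<H e with sameCell? i j i₀ j₀
  ... | inj₁ (refl , refl) = insertSet≢[] y (q i₀ j₀) (trans (sym at) e)
  ... | inj₂ d = full i<H (trans (sym (off i j d)) e)
  empty′ : ∀ {i j} → H j ≤ i → q′ i j ≡ []
  empty′ {i} {j} H≤i with sameCell? i j i₀ j₀
  ... | inj₁ (refl , refl) = contradiction H≤i (<⇒≱ i₀<H)
  ... | inj₂ d = trans (off i j d) (empty H≤i)
... | no i₀≮H = record { shp = S′ ; full = full′ ; empty = empty′
  ; tableaux = trans (cong (λ s → heckeStep s (y , x)) tableaux) (insert y q q′ new old) }
  where
  open State st
  Hj₀ : H j₀ ≡ i₀
  Hj₀ = ≤-antisym (≮⇒≥ i₀≮H) (≮⇒≥ λ H<i₀ → below (H j₀) H<i₀ (empty ≤-refl))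
  open AddCell shp i₀ j₀ x content Hj₀ (λ j j<j₀ → ≰⇒> λ H≤i₀ → left j j<j₀ (empty H≤i₀))
  new : q′ i₀ j₀ ≡ [ y ]
  new = trans at (cong (insertSet y) (empty (≤-reflexive Hj₀)))
  old : ∀ i j → j < μ i → q′ i j ≡ q i j
  old i j j<μ with sameCell? i j i₀ j₀
  ... | inj₁ (refl , refl) = contradiction (to j<μ) i₀≮H
  ... | inj₂ d = off i j d
  full′ : ∀ {i j} → i < H′ j → q′ i j ≢ []
  full′ {i} {j} i<H′ e with sameCell? i j i₀ j₀
  ... | inj₁ (refl , refl) = contradiction (trans (sym new) e) λ ()
  ... | inj₂ d = full (i<H d) (trans (sym (off i j d)) e)
    where
    i<H : i ≢ i₀ ⊎ j ≢ j₀ → i < H j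
    i<H d with j ≟ j₀
    i<H (inj₁ i≢) | yes refl = subst (i <_) (sym Hj₀) (≤∧≢⇒< (≤-pred i<H′) i≢)
    i<H (inj₂ j≢) | yes j≡ = contradiction j≡ j≢
    i<H d | no _ = i<H′
  empty′ : ∀ {i j} → H′ j ≤ i → q′ i j ≡ []
  empty′ {i} {j} H′≤i with sameCell? i j i₀ j₀
  ... | inj₁ (refl , refl) = contradiction (subst (_≤ i₀) (upd-same H j₀) H′≤i) (<⇒≱ ≤-refl)
  ... | inj₂ d = trans (off i j d) (empty H≤i)
    where
    H≤i : H j ≤ i
    H≤i with j ≟ j₀
    ... | yes refl = subst (_≤ i) (sym Hj₀) (<⇒≤ H′≤i)
    ... | no _ = H′≤i

-- Truncating and sorting lists

≢[]⇒∃∈ : ∀ {l : List A} → l ≢ [] → ∃ (_∈ l)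
≢[]⇒∃∈ {l = []} h = contradiction refl h
≢[]⇒∃∈ {l = a ∷ l} h = a , here refl

∈⇒≢[] : ∀ {l : List A} {a} → a ∈ l → l ≢ []
∈⇒≢[] () refl

trunc : ℕ → List ℕ → List ℕ
trunc b = filter (_<? b)

trunc-suc-∉ : ∀ {k} l → k ∉ l → trunc (suc k) l ≡ trunc k l
trunc-suc-∉ [] _ = refl
trunc-suc-∉ {k} (a ∷ l) k∉ with a <? k
... | yes a<k = trans (filter-accept (_<? suc k) (m<n⇒m<1+n a<k))
  (trans (cong (a ∷_) (trunc-suc-∉ l (k∉ ∘ there))) (sym (filter-accept (_<? k) a<k)))
... | no a≮k = trans (filter-reject (_<? suc k) λ a≤k → a≮k (≤∧≢⇒< (≤-pred a≤k) λ a≡k → k∉ (here (sym a≡k))))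
  (trans (trunc-suc-∉ l (k∉ ∘ there)) (sym (filter-reject (_<? k) a≮k)))

-- Truncation at `k` keeps exactly the letters in front of `k`, so `insertSet` walks past all of
-- them and puts `k` at the end.
trunc-suc-∈ : ∀ {k l} → AllPairs _<_ l → k ∈ l → trunc (suc k) l ≡ insertSet k (trunc k l)
trunc-suc-∈ {k} {a ∷ l} (a<l ∷ _) (here refl) = begin
  trunc (suc k) (k ∷ l)       ≡⟨ filter-accept (_<? suc k) ≤-refl ⟩
  k ∷ trunc (suc k) l         ≡⟨ cong (k ∷_) (filter-none (_<? suc k) (All.map (λ k<b → <⇒≱ (s<s k<b)) a<l)) ⟩
  insertSet k []              ≡⟨ cong (insertSet k) (filter-none (_<? k) (n≮n k ∷ All.map <-asym a<l)) ⟨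
  insertSet k (trunc k (k ∷ l)) ∎
  where open ≡-Reasoning
trunc-suc-∈ {k} {a ∷ l} (a<l ∷ l<) (there k∈) = begin
  trunc (suc k) (a ∷ l)        ≡⟨ filter-accept (_<? suc k) (m<n⇒m<1+n a<k) ⟩
  a ∷ trunc (suc k) l          ≡⟨ cong (a ∷_) (trunc-suc-∈ l< k∈) ⟩
  a ∷ insertSet k (trunc k l)  ≡⟨ skip ⟨
  insertSet k (a ∷ trunc k l)  ≡⟨ cong (insertSet k) (filter-accept (_<? k) a<k) ⟨
  insertSet k (trunc k (a ∷ l)) ∎
  where
  open ≡-Reasoning
  a<k = All.lookup a<l k∈
  skip : insertSet k (a ∷ trunc k l) ≡ a ∷ insertSet k (trunc k l)
  skip rewrite <ᵇ-false (<⇒≤ a<k) | ≡ᵇ-false (>⇒≢ a<k) = refl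

insertDec-↭ : ∀ x l → insertDec x l ↭ x ∷ l
insertDec-↭ x [] = ↭-refl
insertDec-↭ x (a ∷ l) with a <ᵇ x
... | true = ↭-refl
... | false = ↭-trans (↭-prep a (insertDec-↭ x l)) (↭-swap a x ↭-refl)

sortDec-↭ : ∀ l → sortDec l ↭ l
sortDec-↭ [] = ↭-refl
sortDec-↭ (x ∷ l) = ↭-trans (insertDec-↭ x (sortDec l)) (↭-prep x (sortDec-↭ l))

Decreasing : List ℕ → Set
Decreasing = AllPairs (λ a b → b < a)

insertDec-decreasing : ∀ x l → All (x ≢_) l → Decreasing l → Decreasing (insertDec x l)
insertDec-decreasing x [] _ _ = [] ∷ []
insertDec-decreasing x (a ∷ l) (x≢a ∷ x≢l) (l<a ∷ dec) with a <ᵇ x in eq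
... | true = (a<x ∷ All.map (λ b<a → <-trans b<a a<x) l<a) ∷ l<a ∷ dec
  where a<x = <ᵇ⇒< a x (≡true⇒T eq)
... | false = All-resp-↭ (↭-sym (insertDec-↭ x l)) (x<a ∷ l<a) ∷ insertDec-decreasing x l x≢l dec
  where
  x<a : x < a
  x<a = ≤∧≢⇒< (≮⇒≥ λ a<x → contradiction (trans (sym (<ᵇ-true a<x)) eq) λ ()) x≢a

sortDec-decreasing : ∀ l → AllPairs _≢_ l → Decreasing (sortDec l)
sortDec-decreasing [] _ = []
sortDec-decreasing (x ∷ l) (x≢l ∷ uniq) = insertDec-decreasing x (sortDec l)
  (All-resp-↭ (↭-sym (sortDec-↭ l)) x≢l) (sortDec-decreasing l uniq)

memb⁺ : ∀ {k l} → k ∈ l → memb k l ≡ true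
memb⁺ {k} k∈ = T⇒≡true (any⁺ (_≡ᵇ k) (Any.map (λ k≡a → ≡⇒≡ᵇ _ k (sym k≡a)) k∈))

memb⁻ : ∀ {k l} → memb k l ≡ true → k ∈ l
memb⁻ {k} {l} e = Any.map (λ t → sym (≡ᵇ⇒≡ _ k t)) (any⁻ (_≡ᵇ k) l (≡true⇒T e))

-- Semistandard set-valued tableaux as functions

-- Positions outside the shape hold the empty set, so membership of a letter already implies that
-- the position is a cell.
record Semistandard (m ℓ : ℕ) (len : ℕ → ℕ) (t : ℕ → ℕ → List ℕ) : Set where
  field
    len-anti : ∀ i → len (suc i) ≤ len i
    len-pos : ∀ {i} → i < ℓ → 0 < len i
    len-zero : ∀ {i} → ℓ ≤ i → len i ≡ 0
    t-empty : ∀ {i j} → len i ≤ j → t i j ≡ []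
    t-full : ∀ {i j} → j < len i → t i j ≢ []
    sorted : ∀ i j → Linked _<_ (t i j)
    range : ∀ {i j a} → a ∈ t i j → 1 ≤ a × a ≤ m
    row≤ : ∀ {i j a b} → a ∈ t i j → b ∈ t i (suc j) → a ≤ b
    col< : ∀ {i j a b} → a ∈ t i j → b ∈ t (suc i) j → a < b

-- Growth of the recording tableau.

module Growth {m ℓ len t} (ss : Semistandard m ℓ len t) where
  open Semistandard ss

  ∈⇒<len : ∀ {i j a} → a ∈ t i j → j < len i
  ∈⇒<len a∈ = ≰⇒> λ len≤j → ∈⇒≢[] a∈ (t-empty len≤j)

  ∈⇒<ℓ : ∀ {i j a} → a ∈ t i j → i < ℓ
  ∈⇒<ℓ a∈ = ≰⇒> λ ℓ≤i → n≮0 (subst (_ <_) (len-zero ℓ≤i) (∈⇒<len a∈))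

  fillˡ : ∀ {i j k b} → b ∈ t i k → j ≤ k → ∃ (_∈ t i j)
  fillˡ b∈ j≤k = ≢[]⇒∃∈ (t-full (≤-<-trans j≤k (∈⇒<len b∈)))

  len-anti* : ∀ {i k} → i ≤ k → len k ≤ len i
  len-anti* {i} {zero} z≤n = ≤-refl
  len-anti* {i} {suc k} i≤1+k with m≤n⇒m<n∨m≡n i≤1+k
  ... | inj₁ (s≤s i≤k) = ≤-trans (len-anti k) (len-anti* i≤k)
  ... | inj₂ refl = ≤-refl

  fillᵈ : ∀ {i j k b} → b ∈ t k j → i ≤ k → ∃ (_∈ t i j)
  fillᵈ b∈ i≤k = ≢[]⇒∃∈ (t-full (<-≤-trans (∈⇒<len b∈) (len-anti* i≤k)))

  -- Chaining the comparisons of neighbours takes a letter in each cell between, which exists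
  -- because the shape has no gaps.
  row≤* : ∀ {i j k a b} → j < k → a ∈ t i j → b ∈ t i k → a ≤ b
  row≤* {k = suc k} j<1+k a∈ b∈ with m≤n⇒m<n∨m≡n (≤-pred j<1+k)
  ... | inj₂ refl = row≤ a∈ b∈
  ... | inj₁ j<k with c , c∈ ← fillˡ b∈ (n≤1+n k) = ≤-trans (row≤* j<k a∈ c∈) (row≤ c∈ b∈)

  col<* : ∀ {i j k a b} → i < k → a ∈ t i j → b ∈ t k j → a < b
  col<* {k = suc k} i<1+k a∈ b∈ with m≤n⇒m<n∨m≡n (≤-pred i<1+k)
  ... | inj₂ refl = col< a∈ b∈
  ... | inj₁ i<k with c , c∈ ← fillᵈ b∈ (n≤1+n k) = <-trans (col<* i<k a∈ c∈) (col< c∈ b∈)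

  -- Compare through the cell in row `i` and column `j′`.
  diag< : ∀ {i j i′ j′ a b} → i < i′ → j < j′ → a ∈ t i j → b ∈ t i′ j′ → a < b
  diag< i<i′ j<j′ a∈ b∈ with c , c∈ ← fillᵈ b∈ (<⇒≤ i<i′) = ≤-<-trans (row≤* j<j′ a∈ c∈) (col<* i<i′ c∈ b∈)

  -- c is the content of cell (i, j), written without subtraction.
  record Occurs (k c i j : ℕ) : Set where
    constructor occurs
    field
      member : k ∈ t i j
      content : c + i ≡ ℓ + j
  open Occurs

  content-of : ∀ {k i j} → k ∈ t i j → Occurs k (ℓ + j ∸ i) i j
  content-of {j = j} k∈ = occurs k∈ (m∸n+n≡m (≤-trans (<⇒≤ (∈⇒<ℓ k∈)) (m≤m+n ℓ j)))

  private
    later-row-absurd : ∀ {k c i j i′ j′} → i < i′ → Occurs k c i j → ¬ Occurs k c i′ j′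
    later-row-absurd {c = c} {i} {j} {i′} {j′} i<i′ o o′ = n≮n _ (diag< i<i′
      (+-cancelˡ-< ℓ j j′ (subst₂ _<_ (content o) (content o′) (+-monoʳ-< c i<i′))) (member o) (member o′))

  -- Cells of equal content lie on one diagonal, along which letters strictly increase.
  occurs-unique : ∀ {k c i j i′ j′} → Occurs k c i j → Occurs k c i′ j′ → i ≡ i′ × j ≡ j′
  occurs-unique {i = i} {j} {i′} {j′} o o′ with <-cmp i i′
  ... | tri< i<i′ _ _ = contradiction o′ (later-row-absurd i<i′ o)
  ... | tri> _ _ i′<i = contradiction o (later-row-absurd i′<i o′)
  ... | tri≈ _ refl _ = refl , +-cancelˡ-≡ ℓ j j′ (trans (sym (content o)) (content o′))

  -- For a cell of `t`, the tested inequality says that its content is less than `c`. There the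
  -- letter `K` is let in; elsewhere only smaller letters are.
  bound : ℕ → ℕ → ℕ → ℕ → ℕ
  bound K c i j with ℓ + j <? c + i
  ... | yes _ = suc K
  ... | no _ = K

  bound-yes : ∀ {K} c i j → ℓ + j < c + i → bound K c i j ≡ suc K
  bound-yes c i j h with ℓ + j <? c + i
  ... | yes _ = refl
  ... | no ¬h = contradiction h ¬h

  bound-no : ∀ {K} c i j → c + i ≤ ℓ + j → bound K c i j ≡ K
  bound-no c i j h with ℓ + j <? c + i
  ... | yes h′ = contradiction h (<⇒≱ h′)
  ... | no _ = refl

  K≤bound : ∀ K c i j → K ≤ bound K c i j
  K≤bound K c i j with ℓ + j <? c + i
  ... | yes _ = n≤1+n K
  ... | no _ = ≤-refl

  bound≤1+K : ∀ K c i j → bound K c i j ≤ suc K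
  bound≤1+K K c i j with ℓ + j <? c + i
  ... | yes _ = ≤-refl
  ... | no _ = n≤1+n K

  -- The part of t recorded once all letters below K, and the letters K in cells of content below c, are inserted.
  stage : ℕ → ℕ → ℕ → ℕ → List ℕ
  stage K c i j = trunc (bound K c i j) (t i j)

  -- Raising `c` to `c′` affects a cell only if it contains `K` and its content lies in between.
  stage-cong : ∀ {K c c′ i j} → c ≤ c′ → (K ∈ t i j → c + i ≤ ℓ + j → ℓ + j < c′ + i → ⊥) →
    stage K c i j ≡ stage K c′ i j
  stage-cong {K} {c} {c′} {i} {j} c≤c′ h with ℓ + j <? c + i | ℓ + j <? c′ + i
  ... | yes _ | yes _ = refl
  ... | no _ | no _ = refl
  ... | yes p | no p′ = contradiction (<-≤-trans p (+-monoˡ-≤ i c≤c′)) p′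
  ... | no p | yes p′ = sym (trunc-suc-∉ (t i j) λ K∈ → h K∈ (≮⇒≥ p) p′)

  ∈-stage : ∀ K c {i j a} → a ∈ t i j → a < bound K c i j → stage K c i j ≢ []
  ∈-stage K c a∈ a<b = ∈⇒≢[] (∈-filter⁺ (_<? _) a∈ a<b)

  ∉-stage : ∀ K c {i j} → (∀ {a} → a ∈ t i j → bound K c i j ≤ a) → stage K c i j ≡ []
  ∉-stage K c h = filter-none (_<? _) (All.tabulate λ a∈ → ≤⇒≯ (h a∈))

  -- This is where the order of insertion matters. Rows may repeat a letter, but a `K` to the left
  -- has smaller content and is already in, and a `K` to the right is not in yet. Columns are
  -- strict, so below and above either value of `bound` will do.
  insert-letter : ∀ {K c i j s} → Occurs K c i j → State ℓ (stage K c) s →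
    State ℓ (stage K (suc c)) (heckeStep s (K , c))
  insert-letter {K} {c} {i₀} {j₀} o@(occurs K∈ c≡) st =
    State-step st i₀ j₀ c K (stage K (suc c)) c≡ at off left below above right
    where
    at : stage K (suc c) i₀ j₀ ≡ insertSet K (stage K c i₀ j₀)
    at rewrite bound-yes {K} (suc c) i₀ j₀ (s≤s (≤-reflexive (sym c≡))) | bound-no {K} c i₀ j₀ (≤-reflexive c≡) =
      trunc-suc-∈ (Linked.Linked⇒AllPairs <-trans (sorted i₀ j₀)) K∈

    off : ∀ i j → i ≢ i₀ ⊎ j ≢ j₀ → stage K (suc c) i j ≡ stage K c i j
    off i j d = sym (stage-cong (n≤1+n c) λ K∈′ lo hi →
      let i≡ , j≡ = occurs-unique (occurs K∈′ (≤-antisym lo (≤-pred hi))) o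
      in [ (λ i≢ → i≢ i≡) , (λ j≢ → j≢ j≡) ]′ d)

    left : ∀ j → j < j₀ → stage K c i₀ j ≢ []
    left j j<j₀ with a , a∈ ← fillˡ K∈ (<⇒≤ j<j₀) = ∈-stage K c a∈
      (subst (a <_) (sym (bound-yes c i₀ j (subst (ℓ + j <_) (sym c≡) (+-monoʳ-< ℓ j<j₀))))
        (s≤s (row≤* j<j₀ a∈ K∈)))

    below : ∀ i → i < i₀ → stage K c i j₀ ≢ []
    below i i<i₀ with a , a∈ ← fillᵈ K∈ (<⇒≤ i<i₀) = ∈-stage K c a∈
      (<-≤-trans (col<* i<i₀ a∈ K∈) (K≤bound K c i j₀))

    above : stage K c (suc i₀) j₀ ≡ []
    above = ∉-stage K c λ a∈ → ≤-trans (bound≤1+K K c (suc i₀) j₀) (col< K∈ a∈)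

    right : stage K c i₀ (suc j₀) ≡ []
    right = ∉-stage K c λ a∈ → subst (_≤ _)
      (sym (bound-no c i₀ (suc j₀) (subst (_≤ ℓ + suc j₀) (sym c≡) (+-monoʳ-≤ ℓ (n≤1+n j₀))))) (row≤ K∈ a∈)

  insertAll : ℕ → List ℕ → Tableau × SVTableau → Tableau × SVTableau
  insertAll K l s = foldr (λ c s → heckeStep s (K , c)) s l

  -- `foldr` inserts the smallest content first. The tail leads to the stage at `x`, the letter `x`
  -- to the stage at `suc x`, and no occurrence of `K` has a content strictly between `x` and `C`.
  insert-letters : ∀ K C l {s} → Decreasing l → All (_< C) l → (∀ {c} → c ∈ l → ∃₂ (Occurs K c)) →
    (∀ {c i j} → Occurs K c i j → c < C → c ∈ l) → State ℓ (stage K 0) s →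
    State ℓ (stage K C) (insertAll K l s)
  insert-letters K C [] _ _ _ complete st = State-cong (λ i j → stage-cong z≤n λ K∈ _ hi →
    contradiction (complete (content-of K∈) (+-cancelʳ-< i _ C
      (subst (_< C + i) (sym (Occurs.content (content-of K∈))) hi))) λ ()) st
  insert-letters K C (x ∷ l) (l<x ∷ dec) (x<C ∷ l<C) sound complete st =
    State-cong (λ i j → stage-cong x<C (skipped i j)) (insert-letter (proj₂ (proj₂ (sound (here refl))))
      (insert-letters K x l dec l<x (sound ∘ there) complete′ st))
    where
    complete′ : ∀ {c i j} → Occurs K c i j → c < x → c ∈ l
    complete′ o c<x with complete o (<-trans c<x x<C)
    ... | here refl = contradiction c<x (n≮n _)
    ... | there c∈l = c∈l
    skipped : ∀ i j → K ∈ t i j → suc x + i ≤ ℓ + j → ℓ + j < C + i → ⊥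
    skipped i j K∈ lo hi = <⇒≱ (+-cancelʳ-≤ i _ _ (subst (suc x + i ≤_) (sym (Occurs.content o)) lo)) c≤x
      where
      o = content-of K∈
      c≤x : ℓ + j ∸ i ≤ x
      c≤x with complete o (+-cancelʳ-< i _ C (subst (_< C + i) (sym (Occurs.content o)) hi))
      ... | here c≡x = ≤-reflexive c≡x
      ... | there c∈l = <⇒≤ (All.lookup l<x c∈l)

  -- Past all contents of `K`, truncating at `K` or at `suc K` makes no difference. Rows from `ℓ` on
  -- are split off: there `bound` may exceed its base value even for content 0, but the cells are
  -- empty.
  stage-next : ∀ {K C} → (∀ {c i j} → Occurs K c i j → c < C) → ∀ i j → stage K C i j ≡ stage (suc K) 0 i j
  stage-next {K} {C} bounded i j with i <? ℓ
  ... | no i≮ℓ rewrite t-empty {i} {j} (subst (_≤ j) (sym (len-zero (≮⇒≥ i≮ℓ))) z≤n) = refl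
  ... | yes i<ℓ rewrite bound-no {suc K} 0 i j (≤-trans (<⇒≤ i<ℓ) (m≤m+n ℓ j)) with ℓ + j <? C + i
  ... | yes _ = refl
  ... | no ≮C = sym (trunc-suc-∉ (t i j) λ K∈ →
    let o = content-of K∈ in ≮C (subst (_< C + i) (Occurs.content o) (+-monoˡ-< i (bounded o))))

  -- The contents listed in the reading word.

  -- `f` is row `r` from column `J` on; `suc r` and `suc J` are the 1-indexed coordinates of
  -- `rowContents`, with the same content. The bound on `j` is what `row-unique` uses.
  row-sound : ∀ {k r c} → r < ℓ → ∀ n J f → (∀ s → f s ≡ t r (J + s)) →
    c ∈ rowContents ℓ k (suc r) (suc J) (applyUpTo f n) → ∃ λ j → J ≤ j × Occurs k c r j
  row-sound {k} {r} r<ℓ (suc n) J f f≡ c∈ with memb k (f 0) in eq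
  row-sound {k} {r} r<ℓ (suc n) J f f≡ (here refl) | true =
    J , ≤-refl , subst (λ c → Occurs k c r J) (cong (_∸ suc r) (sym (+-suc ℓ J)))
      (content-of (subst (k ∈_) (trans (f≡ 0) (cong (t r) (+-identityʳ J))) (memb⁻ eq)))
  row-sound {k} {r} r<ℓ (suc n) J f f≡ (there c∈) | true
    with j , J<j , o ← row-sound r<ℓ n (suc J) (f ∘ suc) (λ s → trans (f≡ (suc s)) (cong (t r) (+-suc J s))) c∈
    = j , <⇒≤ J<j , o
  row-sound {k} {r} r<ℓ (suc n) J f f≡ c∈ | false
    with j , J<j , o ← row-sound r<ℓ n (suc J) (f ∘ suc) (λ s → trans (f≡ (suc s)) (cong (t r) (+-suc J s))) c∈
    = j , <⇒≤ J<j , o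

  row-complete : ∀ {k r c} n J f → (∀ s → f s ≡ t r (J + s)) → ∀ s → s < n → Occurs k c r (J + s) →
    c ∈ rowContents ℓ k (suc r) (suc J) (applyUpTo f n)
  row-complete {k} {r} {c} (suc n) J f f≡ zero _ (occurs k∈ c≡)
    rewrite memb⁺ (subst (k ∈_) (sym (f≡ 0)) k∈) | +-suc ℓ J =
    here (trans (sym (m+n∸n≡m c r)) (cong (_∸ r) (trans c≡ (cong (ℓ +_) (+-identityʳ J)))))
  row-complete {k} {r} {c} (suc n) J f f≡ (suc s) (s<s s<n) o = ∈-++⁺ʳ _
    (row-complete n (suc J) (f ∘ suc) (λ s → trans (f≡ (suc s)) (cong (t r) (+-suc J s))) s s<n
      (subst (Occurs k c r) (+-suc J s) o))

  row-unique : ∀ {k r} → r < ℓ → ∀ n J f → (∀ s → f s ≡ t r (J + s)) →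
    AllPairs _≢_ (rowContents ℓ k (suc r) (suc J) (applyUpTo f n))
  row-unique r<ℓ zero J f f≡ = []
  row-unique {k} {r} r<ℓ (suc n) J f f≡ = AllPairs.++⁺ head-unique
    (row-unique r<ℓ n (suc J) (f ∘ suc) f≡′)
    (All.tabulate λ x∈ → All.tabulate λ y∈ x≡y → apart x∈ y∈ x≡y)
    where
    f≡′ : ∀ s → f (suc s) ≡ t r (suc J + s)
    f≡′ s = trans (f≡ (suc s)) (cong (t r) (+-suc J s))
    head-unique : AllPairs _≢_ (if memb k (f 0) then [ ℓ + suc J ∸ suc r ] else [])
    head-unique with memb k (f 0)
    ... | true = [] ∷ []
    ... | false = []
    apart : ∀ {x y} → x ∈ (if memb k (f 0) then [ ℓ + suc J ∸ suc r ] else []) →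
      y ∈ rowContents ℓ k (suc r) (suc (suc J)) (applyUpTo (f ∘ suc) n) → x ≢ y
    apart x∈ y∈ refl with memb k (f 0) | row-sound r<ℓ n (suc J) (f ∘ suc) f≡′ y∈
    apart (here refl) y∈ refl | true | j , J<j , occurs _ c≡ =
      <⇒≢ (+-monoʳ-< ℓ J<j) (trans (sym (m∸n+n≡m (≤-trans (<⇒≤ r<ℓ) (m≤m+n ℓ J))))
        (trans (cong (λ z → z ∸ suc r + r) (sym (+-suc ℓ J))) c≡))

  RowsFrom : ℕ → (ℕ → List (List ℕ)) → Set
  RowsFrom r rows = ∀ s → rows s ≡ applyUpTo (t (r + s)) (len (r + s))

  rowsFrom-tail : ∀ {r rows} → RowsFrom r rows → RowsFrom (suc r) (rows ∘ suc)
  rowsFrom-tail {r} rows≡ s = trans (rows≡ (suc s)) (cong (λ i → applyUpTo (t i) (len i)) (+-suc r s))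

  rowsFrom-head : ∀ {r rows} → RowsFrom r rows → rows 0 ≡ applyUpTo (t r) (len r)
  rowsFrom-head {r} rows≡ = trans (rows≡ 0) (cong (λ i → applyUpTo (t i) (len i)) (+-identityʳ r))

  all-sound : ∀ {k c} n r rows → RowsFrom r rows → r + n ≤ ℓ →
    c ∈ allContents ℓ k (suc r) (applyUpTo rows n) → ∃₂ λ i j → r ≤ i × Occurs k c i j
  all-sound {k} {c} (suc n) r rows rows≡ r+n≤ℓ c∈ with ∈-++⁻ (rowContents ℓ k (suc r) 1 (rows 0)) c∈
  ... | inj₁ c∈row
    with j , _ , o ← row-sound (≤-trans (m<m+n r z<s) r+n≤ℓ) (len r) 0 (t r) (λ _ → refl)
      (subst (λ R → c ∈ rowContents ℓ k (suc r) 1 R) (rowsFrom-head rows≡) c∈row)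
    = r , j , ≤-refl , o
  ... | inj₂ c∈rest
    with i , j , r<i , o ← all-sound n (suc r) (rows ∘ suc) (rowsFrom-tail rows≡)
      (subst (_≤ ℓ) (+-suc r n) r+n≤ℓ) c∈rest
    = i , j , <⇒≤ r<i , o

  all-complete : ∀ {k c j} n r rows → RowsFrom r rows → ∀ s → s < n → Occurs k c (r + s) j →
    c ∈ allContents ℓ k (suc r) (applyUpTo rows n)
  all-complete {k} {c} {j} (suc n) r rows rows≡ zero _ o rewrite +-identityʳ r | rowsFrom-head rows≡ =
    ∈-++⁺ˡ (row-complete (len r) 0 (t r) (λ _ → refl) j (∈⇒<len (member o)) o)
  all-complete {k} {c} {j} (suc n) r rows rows≡ (suc s) (s<s s<n) o = ∈-++⁺ʳ (rowContents ℓ k (suc r) 1 (rows 0))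
    (all-complete n (suc r) (rows ∘ suc) (rowsFrom-tail rows≡) s s<n
      (subst (λ i → Occurs k c i j) (+-suc r s) o))

  -- Different rows share contents in general, but by `occurs-unique` not in cells with a common
  -- letter.
  all-unique : ∀ {k} n r rows → RowsFrom r rows → r + n ≤ ℓ →
    AllPairs _≢_ (allContents ℓ k (suc r) (applyUpTo rows n))
  all-unique zero r rows rows≡ _ = []
  all-unique {k} (suc n) r rows rows≡ r+n≤ℓ rewrite rowsFrom-head rows≡ =
    AllPairs.++⁺ (row-unique r<ℓ (len r) 0 (t r) (λ _ → refl))
      (all-unique n (suc r) (rows ∘ suc) (rowsFrom-tail rows≡) 1+r+n≤ℓ)
      (All.tabulate λ x∈ → All.tabulate λ y∈ x≡y → apart x∈ y∈ x≡y)
    where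
    r<ℓ = ≤-trans (m<m+n r z<s) r+n≤ℓ
    1+r+n≤ℓ = subst (_≤ ℓ) (+-suc r n) r+n≤ℓ
    apart : ∀ {x y} → x ∈ rowContents ℓ k (suc r) 1 (applyUpTo (t r) (len r)) →
      y ∈ allContents ℓ k (suc (suc r)) (applyUpTo (rows ∘ suc) n) → x ≢ y
    apart x∈ y∈ refl
      with _ , _ , o ← row-sound r<ℓ (len r) 0 (t r) (λ _ → refl) x∈
      with _ , _ , r<i , o′ ← all-sound n (suc r) (rows ∘ suc) (rowsFrom-tail rows≡) 1+r+n≤ℓ y∈
      = <⇒≢ r<i (proj₁ (occurs-unique o o′))

-- Insertion of the whole biword.

≤-by-< : ∀ {m n} → (∀ i → i < m → i < n) → m ≤ n
≤-by-< h = ≮⇒≥ λ n<m → n≮n _ (h _ n<m)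

bounded : ∀ l → ∃ λ C → All (_< C) l
bounded [] = 0 , []
bounded (x ∷ l) with C , l<C ← bounded l =
  suc x ⊔ C , m≤m⊔n (suc x) C ∷ All.map (λ a<C → ≤-trans a<C (m≤n⊔m (suc x) C)) l<C

hecke-recovers : ∀ m T len t → T ≡ tab (length T) len t → Semistandard m (length T) len t →
  proj₂ (heckeInsertRight (heckeBiword m T)) ≡ T
-- A left fold over the reversed word is a right fold over the word, which follows the recursion of
-- `biwordFrom`.
hecke-recovers m T len t T≡ ss = trans (cong proj₂ (reverse-foldl heckeStep ([] , []) (biwordFrom m T)))
  (trans (cong proj₂ tableaux) (trans (cong (λ n → tab n μ t) H0≡)
    (trans (tab-cong ℓ (λ i _ → μ≡ i) λ _ _ _ _ → refl) (sym T≡))))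
  where
  open Semistandard ss
  open Growth ss
  ℓ = length T

  step : ℕ × ℕ → Tableau × SVTableau → Tableau × SVTableau
  step col s = heckeStep s col

  run : ℕ → Tableau × SVTableau
  run k = foldr step ([] , []) (biwordFrom k T)

  phase : ∀ k → State ℓ (stage (suc k) 0) (run k)
  -- Letters are at least 1, so truncation at 1 empties every cell.
  phase zero = State-init λ i j → filter-none (_<? _) (All.tabulate λ a∈ → ≤⇒≯
    (≤-trans (≤-reflexive (bound-no 0 i j (≤-trans (<⇒≤ (∈⇒<ℓ a∈)) (m≤m+n ℓ j)))) (proj₁ (range a∈))))
  phase (suc k) = State-cong (stage-next λ o → All.lookup <C (complete o)) (subst (State ℓ (stage K C)) run≡
    (insert-letters K C h decreasing <C sound (λ o _ → complete o) (phase k)))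
    where
    K = suc k
    h = hWord K T
    C = proj₁ (bounded h)
    <C = proj₂ (bounded h)
    run≡ : insertAll K h (run k) ≡ run (suc k)
    run≡ = trans (sym (foldr-map step (K ,_) (run k) h)) (sym (foldr-++ step ([] , []) (map (K ,_) h) (biwordFrom k T)))
    decreasing : Decreasing h
    decreasing = sortDec-decreasing _ (subst (λ X → AllPairs _≢_ (allContents ℓ K 1 X)) (sym T≡)
      (all-unique ℓ 0 _ (λ _ → refl) ≤-refl))
    sound : ∀ {c} → c ∈ h → ∃₂ (Occurs K c)
    sound {c} c∈ with i , j , _ , o ← all-sound ℓ 0 _ (λ _ → refl) ≤-refl
      (subst (λ X → c ∈ allContents ℓ K 1 X) T≡ (∈-resp-↭ (sortDec-↭ _) c∈)) = i , j , o
    complete : ∀ {c i j} → Occurs K c i j → c ∈ h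
    complete {c} {i} o = ∈-resp-↭ (↭-sym (sortDec-↭ _)) (subst (λ X → c ∈ allContents ℓ K 1 X) (sym T≡)
      (all-complete ℓ 0 _ (λ _ → refl) i (∈⇒<ℓ (Occurs.member o)) o))

  final : State ℓ t (run m)
  final = State-cong (λ i j → filter-all (_<? _) (All.tabulate λ a∈ →
    ≤-trans (s≤s (proj₂ (range a∈))) (K≤bound (suc m) 0 i j))) (phase m)
  open State final

  -- The final shape and the shape of `T` are both the set of nonempty cells of `t`.
  μ≡ : ∀ i → μ i ≡ len i
  μ≡ i = ≤-antisym (≤-by-< λ j j<μ → ≰⇒> λ len≤j → full (to j<μ) (t-empty len≤j))
    (≤-by-< λ j j<len → from (≰⇒> λ H≤i → t-full j<len (empty H≤i)))

  H0≡ : H 0 ≡ ℓ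
  H0≡ = ≤-antisym
    (≤-by-< λ i i<H → ≰⇒> λ ℓ≤i → n≮0 (subst (0 <_) (trans (μ≡ i) (len-zero ℓ≤i)) (from i<H)))
    (≤-by-< λ i i<ℓ → to (subst (0 <_) (sym (μ≡ i)) (len-pos i<ℓ)))

-- From lists to functions

-- Used with default `[]` for a missing row and for a missing cell alike, so that positions outside
-- `T` hold the empty set.
nth : A → List A → ℕ → A
nth d [] i = d
nth d (x ∷ xs) zero = x
nth d (x ∷ xs) (suc i) = nth d xs i

applyUpTo-nth : ∀ (d : A) xs → xs ≡ applyUpTo (nth d xs) (length xs)
applyUpTo-nth d [] = refl
applyUpTo-nth d (x ∷ xs) = cong (x ∷_) (applyUpTo-nth d xs)

nth-default : ∀ (d : A) xs {i} → length xs ≤ i → nth d xs i ≡ d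
nth-default d [] _ = refl
nth-default d (x ∷ xs) (s≤s h) = nth-default d xs h

nth-All : ∀ {P : A → Set} {d xs} → All P xs → ∀ {i} → i < length xs → P (nth d xs i)
nth-All (p ∷ ps) {zero} _ = p
nth-All (p ∷ ps) {suc i} (s<s h) = nth-All ps h

nth-Linked : ∀ {R : A → A → Set} {d xs} → Linked R xs → ∀ {i} → suc i < length xs →
  R (nth d xs i) (nth d xs (suc i))
nth-Linked [-] (s<s ())
nth-Linked (r ∷ rs) {zero} _ = r
nth-Linked (r ∷ rs) {suc i} (s<s h) = nth-Linked rs h

nth-ColRel : ∀ L U → ColRel L U → ∀ {j} → j < length L → j < length U →
  maxL (nth [] L j) < minL (nth [] U j)
nth-ColRel (A ∷ L) (C ∷ U) (r , _) {zero} _ _ = r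
nth-ColRel (A ∷ L) (C ∷ U) (_ , rs) {suc j} (s<s p) (s<s q) = nth-ColRel L U rs p q

∈⇒≤maxL : ∀ {a l} → a ∈ l → a ≤ maxL l
∈⇒≤maxL {l = b ∷ l} (here refl) = m≤m⊔n b (maxL l)
∈⇒≤maxL {l = b ∷ l} (there a∈) = ≤-trans (∈⇒≤maxL a∈) (m≤n⊔m b (maxL l))

-- The head is the base value of the fold in `minL`, so the induction removes the second entry and
-- keeps the head.
minL-∷ : ∀ a l → minL (a ∷ l) ≤ a × (∀ {b} → b ∈ l → minL (a ∷ l) ≤ b)
minL-∷ a [] = ≤-refl , λ ()
minL-∷ a (c ∷ l) with ≤a , ≤l ← minL-∷ a l =
  ≤-trans (m⊓n≤n c _) ≤a ,
  λ { (here refl) → m⊓n≤m c _ ; (there b∈) → ≤-trans (m⊓n≤n c _) (≤l b∈) }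

∈⇒minL≤ : ∀ {b l} → b ∈ l → minL l ≤ b
∈⇒minL≤ {l = a ∷ l} (here refl) = proj₁ (minL-∷ a l)
∈⇒minL≤ {l = a ∷ l} (there b∈) = proj₂ (minL-∷ a l) b∈

∈-nth : ∀ (xs : List (List A)) {i a} → a ∈ nth [] xs i → i < length xs
∈-nth xs a∈ = ≰⇒> λ h → ∈⇒≢[] a∈ (nth-default [] xs h)

semistandard : ∀ {m} T → IsPartition (shape T) → SemistandardSV m T →
  Semistandard m (length T) (λ i → length (nth [] T i)) (λ i → nth [] (nth [] T i))
semistandard {m} T (anti , pos) (good , rows , cols) = record
  { len-anti = len-anti
  ; len-pos = nth-All (All.map⁻ pos)
  ; len-zero = len-zero
  ; t-empty = λ {i} → nth-default [] (nth [] T i)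
  ; t-full = λ j<len → proj₁ (good-cell j<len)
  ; sorted = sorted
  ; range = λ {i} {j} a∈ → All.lookup (proj₂ (proj₂ (good-cell (∈-nth (nth [] T i) a∈)))) a∈
  ; row≤ = λ {i} {j} a∈ b∈ → let j<len = ∈-nth (nth [] T i) b∈ in
      ≤-trans (∈⇒≤maxL a∈) (≤-trans (nth-Linked (nth-All rows (row-exists j<len)) j<len) (∈⇒minL≤ b∈))
  ; col< = λ {i} {j} a∈ b∈ → let j<len = ∈-nth (nth [] T (suc i)) b∈ in
      ≤-<-trans (∈⇒≤maxL a∈) (<-≤-trans
        (nth-ColRel (nth [] T i) (nth [] T (suc i)) (nth-Linked cols (row-exists j<len))
          (∈-nth (nth [] T i) a∈) j<len) (∈⇒minL≤ b∈)) }
  where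
  len-zero : ∀ {i} → length T ≤ i → length (nth [] T i) ≡ 0
  len-zero h = cong length (nth-default [] T h)

  row-exists : ∀ {i j} → j < length (nth [] T i) → i < length T
  row-exists j<len = ≰⇒> λ h → n≮0 (subst (_ <_) (len-zero h) j<len)

  len-anti : ∀ i → length (nth [] T (suc i)) ≤ length (nth [] T i)
  len-anti i with suc i <? length T
  ... | yes h = nth-Linked (Linked.map⁻ anti) h
  ... | no h = subst (_≤ length (nth [] T i)) (sym (len-zero (≮⇒≥ h))) z≤n

  good-cell : ∀ {i j} → j < length (nth [] T i) → GoodCell m (nth [] (nth [] T i) j)
  good-cell j<len = nth-All (nth-All good (row-exists j<len)) j<len

  sorted : ∀ i j → Linked _<_ (nth [] (nth [] T i) j)
  sorted i j with j <? length (nth [] T i)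
  ... | yes j<len = proj₁ (proj₂ (good-cell j<len))
  ... | no j≮len = subst (Linked _<_) (sym (nth-default [] (nth [] T i) (≮⇒≥ j≮len))) []

theorem3p5 : (λ′ : List ℕ) → IsPartition λ′ → (m : ℕ) → (T : SVTableau) →
    shape T ≡ λ′ → SemistandardSV m T →
    proj₂ (heckeInsertRight (heckeBiword m T)) ≡ T
theorem3p5 _ part m T refl ssv = hecke-recovers m T _ _
  (trans (applyUpTo-nth [] T) (applyUpTo-cong (length T) λ i _ → applyUpTo-nth [] (nth [] T i)))
  (semistandard T part ssv)
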